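{- Let $p$ be a prime and let $C(x_1,\ldots,x_r)=\sum_{i,j,k=1}^r a_{ijk}x_ix_jx_k$ be a non-degenerate cubic form with integer coefficients $a_{ijk}$ that is primitive, in $r>9$ variables. Then $R(C)$ is dense in $\mathbb{Q}_p$.
   Context: $C$ is primitive if no integer $d>1$ divides all $a_{ijk}$. Two cubic forms $C_1,C_2$ over $\mathbb{Q}_p$ are equivalent if $C_1(\overline{x})=C_2(T\overline{x})$ for some non-singular linear transformation $T$ over $\mathbb{Q}_p$; the order of $C$ is the least $m$ such that $C$ is equivalent (over $\mathbb{Q}_p$) to a form explicitly involving only $m$ variables, and a cubic form in $n$ variables is non-degenerate if its order equals $n$. $R(C)=\{C(\overline{x})/C(\overline{y}) : \overline{x},\overline{y}\in\mathbb{Z}^r,\ C(\overline{y})\neq 0\}$, with density in the $p$-adic topology. -}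

module Defs where

open import Data.Nat using (ℕ; zero; suc; _≤_; _<_; _^_)
import Data.Nat as ℕ
open import Data.Integer using (ℤ; +_; _+_; _*_; -_; _-_)
open import Data.Integer.Divisibility using (_∣_)
open import Data.Fin using (Fin; zero; suc; toℕ)
open import Data.Product using (Σ; ∃; _×_; _,_)
open import Relation.Nullary using (¬_)

sumFin : {A : Set} → A → (A → A → A) → (n : ℕ) → (Fin n → A) → A
sumFin z _⊕_ zero    f = z
sumFin z _⊕_ (suc n) f = f zero ⊕ sumFin z _⊕_ n (λ i → f (suc i))

CubicFormℤ : ℕ → Set
CubicFormℤ r = Fin r → Fin r → Fin r → ℤ

evalℤ : {r : ℕ} → CubicFormℤ r → (Fin r → ℤ) → ℤ
evalℤ {r} a x =
  sumFin (+ 0) _+_ r λ i → sumFin (+ 0) _+_ r λ j → sumFin (+ 0) _+_ r λ k →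
    a i j k * (x i * (x j * x k))

Primitive : {r : ℕ} → CubicFormℤ r → Set
Primitive {r} a = (d : ℕ) → 1 < d → ¬ ((i j k : Fin r) → (+ d) ∣ a i j k)

-- p-adic numbers, built from scratch.
--
-- ℤ_p : an element is a sequence x : ℕ → ℤ that is coherent,
--   x j ≡ x k (mod p^k) for k ≤ j  (x k is its residue mod p^k);
--   two such are equal iff x k ≡ y k (mod p^k) for every k.
-- ℚ_p : an element is a pair  num / p^den  with num ∈ ℤ_p, den ∈ ℕ.
-- Ring operations are pointwise (no normalisation needed); validity
-- (coherence) is a separate predicate, preserved by the operations.

module Padic (p : ℕ) where

  pz : ℕ → ℤ
  pz k = + (p ^ k)

  Coherent : (ℕ → ℤ) → Set
  Coherent x = (k j : ℕ) → k ≤ j → pz k ∣ (x j - x k)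

  _≈z_ : (ℕ → ℤ) → (ℕ → ℤ) → Set
  x ≈z y = (k : ℕ) → pz k ∣ (x k - y k)

  record Qp : Set where
    constructor _/p^_
    field
      num : ℕ → ℤ
      den : ℕ
  open Qp public

  Valid : Qp → Set
  Valid q = Coherent (num q)

  _≈_ : Qp → Qp → Set
  q ≈ s = (λ k → pz (den s) * num q k) ≈z (λ k → pz (den q) * num s k)

  _+q_ : Qp → Qp → Qp
  q +q s = (λ k → pz (den s) * num q k + pz (den q) * num s k) /p^ (den q ℕ.+ den s)

  _*q_ : Qp → Qp → Qp
  q *q s = (λ k → num q k * num s k) /p^ (den q ℕ.+ den s)

  -q_ : Qp → Qp
  -q q = (λ k → - num q k) /p^ den q

  fromℤ : ℤ → Qp
  fromℤ c = (λ _ → c) /p^ 0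

  0q 1q : Qp
  0q = fromℤ (+ 0)
  1q = fromℤ (+ 1)

  -- |q|_p ≤ p^(-N)
  InBall : ℕ → Qp → Set
  InBall N q = Σ (ℕ → ℤ) λ w → Coherent w × (num q ≈z (λ k → pz (N ℕ.+ den q) * w k))

  VecQ : ℕ → Set
  VecQ r = Fin r → Qp

  ValidVec : {r : ℕ} → VecQ r → Set
  ValidVec {r} x = (i : Fin r) → Valid (x i)

  MatQ : ℕ → Set
  MatQ r = Fin r → Fin r → Qp

  ValidMat : {r : ℕ} → MatQ r → Set
  ValidMat {r} T = (i j : Fin r) → Valid (T i j)

  _·_ : {r : ℕ} → MatQ r → VecQ r → VecQ r
  _·_ {r} T x i = sumFin 0q _+q_ r λ j → T i j *q x j

  _⊗_ : {r : ℕ} → MatQ r → MatQ r → MatQ r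
  _⊗_ {r} S T i k = sumFin 0q _+q_ r λ j → S i j *q T j k

  idMat : {r : ℕ} → MatQ r
  idMat i j with toℕ i ℕ.≟ toℕ j
  ... | Relation.Nullary.yes _ = 1q
  ... | Relation.Nullary.no  _ = 0q

  _≈M_ : {r : ℕ} → MatQ r → MatQ r → Set
  _≈M_ {r} S T = (i j : Fin r) → S i j ≈ T i j

  NonSingular : {r : ℕ} → MatQ r → Set
  NonSingular {r} T =
    Σ (MatQ r) λ S → ValidMat S × ((S ⊗ T) ≈M idMat) × ((T ⊗ S) ≈M idMat)

  CubicFormQ : ℕ → Set
  CubicFormQ r = Fin r → Fin r → Fin r → Qp

  ValidForm : {r : ℕ} → CubicFormQ r → Set
  ValidForm {r} D = (i j k : Fin r) → Valid (D i j k)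

  evalQ : {r : ℕ} → CubicFormQ r → VecQ r → Qp
  evalQ {r} D x =
    sumFin 0q _+q_ r λ i → sumFin 0q _+q_ r λ j → sumFin 0q _+q_ r λ k →
      D i j k *q (x i *q (x j *q x k))

  InvolvesOnly : {r : ℕ} → ℕ → CubicFormQ r → Set
  InvolvesOnly {r} m D =
    (i j k : Fin r) → ¬ (toℕ i < m × toℕ j < m × toℕ k < m) → D i j k ≈ 0q

  liftForm : {r : ℕ} → CubicFormℤ r → CubicFormQ r
  liftForm a i j k = fromℤ (a i j k)

  EquivToFormIn : {r : ℕ} → CubicFormℤ r → ℕ → Set
  EquivToFormIn {r} a m =
    Σ (CubicFormQ r) λ D → Σ (MatQ r) λ T →
      ValidForm D × ValidMat T × NonSingular T × InvolvesOnly m D ×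
      ((x : VecQ r) → ValidVec x → evalQ (liftForm a) x ≈ evalQ D (T · x))

  NonDegenerate : {r : ℕ} → CubicFormℤ r → Set
  NonDegenerate {r} a = (m : ℕ) → m < r → ¬ EquivToFormIn a m

  -- R(C) = { C(x)/C(y) : x,y ∈ ℤ^r, C(y) ≠ 0 } is dense in ℚ_p:
  -- for every α ∈ ℚ_p and N there are x, y with C(y) ≠ 0 and
  -- C(x)/C(y) - α = γ with |γ|_p ≤ p^(-N)   (i.e. C(x) - α C(y) = γ C(y)).
  DenseRatios : {r : ℕ} → CubicFormℤ r → Set
  DenseRatios {r} a =
    (α : Qp) → Valid α → (N : ℕ) →
      Σ (Fin r → ℤ) λ x → Σ (Fin r → ℤ) λ y →
        ¬ (evalℤ a y ≡ + 0) × Σ Qp λ γ → Valid γ × InBall N γ ×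
          ((fromℤ (evalℤ a x) +q (-q (α *q fromℤ (evalℤ a y)))) ≈ (γ *q fromℤ (evalℤ a y)))
    where open import Relation.Binary.PropositionalEquality using (_≡_)

{-# OPTIONS --safe #-}
module Submission where

-- Call (x , y) a smooth point of C at scale pᵏ if C is divisible by pᵏ on ℤx + ℤy, with C(x) even
-- divisible by pᵏ⁺¹, while the coefficient of t in C(x + t y) is not.  Newton's method then makes
-- C(x + t y) / pᵏ⁺¹ approximate every p-adic integer, so that the ratios of values of C are dense.
--
-- If there is no smooth point at the scales 1, p, p², then by Chevalley's theorem the vectors
-- with p | C(x) form a sublattice of corank at most 3 modulo p, on which C / p is integral, and
-- this repeats three times.  In more than nine variables there remains w ∉ pℤʳ in the third
-- sublattice, and C is integral on the lattice ℤʳ + ℤ w/p.  (This is the reduction in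
-- Davenport's proof that cubic forms in ten variables have p-adic zeros.)
--
-- For non-degenerate C all lattices on which C is integral and which contain ℤʳ lie in Δ⁻¹ℤʳ for
-- a fixed Δ ≠ 0, so that the lattice can be enlarged only finitely often before a smooth point
-- shows up.  A degenerate C has an integral kernel vector, which a unimodular substitution turns
-- into a multiple of the last basis vector.

open import Defs
open import Data.Nat using (ℕ; zero; suc; _<_; z≤n; s≤s; _^_)
import Data.Nat as ℕ
import Data.Nat.Properties as ℕₚ
import Data.Nat.Divisibility as ℕᵈ
open import Data.Nat.Primality using (Prime; euclidsLemma; prime⇒nonZero; prime⇒irreducible; prime⇒nonTrivial)
import Data.Nat.GCD as GCD
open import Data.Integer using (ℤ; +_; -[1+_]; _+_; _*_; -_; _-_; NonZero) renaming (∣_∣ to abs)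
import Data.Integer as ℤ
import Data.Integer.Properties as ℤₚ
import Data.Integer.DivMod as ℤᵈ
import Data.Integer.Divisibility as Unsigned
open import Data.Integer.Divisibility.Signed
open import Data.Integer.Tactic.RingSolver using (solve-∀)
open import Data.Vec using (Vec; []; _∷_; lookup; zipWith; map; replicate; tabulate; insertAt; tail)
import Data.Vec.Properties as Vecₚ
open import Data.Fin using (Fin; zero; suc; toℕ)
import Data.Fin as Fin
import Data.Fin.Properties as Finₚ
open import Data.Product using (∃; _×_; _,_; proj₁; proj₂)
open import Data.Sum using (_⊎_; inj₁; inj₂; [_,_]′)
open import Data.Empty using (⊥-elim)
open import Relation.Nullary using (¬_; Dec; yes; no)
open import Relation.Nullary.Decidable using (map′; _×-dec_; ¬?; decidable-stable)
open import Relation.Binary.PropositionalEquality using (_≡_; _≢_; refl; sym; trans; cong; cong₂; subst; subst₂; module ≡-Reasoning)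
open import Data.Unit using (⊤; tt)

-- Integer vectors and linear maps

-- The primes 2 and 3 shape the data. A symmetric trilinear form would bring in the denominator 6,
-- so a cubic map is a pair `F`, `G`, with `G x y` the coefficient of t in F(x + t y). Smooth
-- points, Newton's method and division by powers of p are expressed through `F` and `G` alone. The
-- symmetric form `Φ` serves where the factors 2 and 3 do no harm: for degrees, for the bound Δ, and
-- for kernels over ℤ.
--
-- Nine is three times three. Chevalley's theorem for a cubic asks for four variables, so each step
-- stops with three left over. Three steps are made because C(w / p) = C(w) / p³. For the same
-- reason pℤʳ lies in the third sublattice, so that C is integral on the sum ℤʳ + ℤ w/p and not
-- merely at w/p.
--
-- Δ exists because Φ(eᵢ, eⱼ, y) is an integer for every y of a lattice that contains ℤʳ and on
-- which C is integral: an integral linear system without kernel bounds the denominators of its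
-- solutions.
--
-- Constructively, the existence of a smooth point has to be decided. It depends only on residues
-- modulo pᵏ⁺¹, so a finite search does it. The number of enlargements is bounded beforehand by the
-- number |Δ|ʳ of classes modulo Δ.

V : ℕ → Set
V = Vec ℤ

infixl 6 _⊕_
infixr 7 _•_

_⊕_ : ∀ {n} → V n → V n → V n
_⊕_ = zipWith _+_

_•_ : ∀ {n} → ℤ → V n → V n
c • x = map (c *_) x

𝟘 : ∀ {n} → V n
𝟘 = replicate _ (+ 0)

𝟙 : ∀ {n} → Fin n → V n
𝟙 zero    = + 1 ∷ 𝟘
𝟙 (suc i) = + 0 ∷ 𝟙 i

⊕-comm : ∀ {n} (x y : V n) → x ⊕ y ≡ y ⊕ x
⊕-comm = Vecₚ.zipWith-comm ℤₚ.+-comm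

⊕-assoc : ∀ {n} (x y z : V n) → (x ⊕ y) ⊕ z ≡ x ⊕ (y ⊕ z)
⊕-assoc = Vecₚ.zipWith-assoc ℤₚ.+-assoc

⊕-identityˡ : ∀ {n} (x : V n) → 𝟘 ⊕ x ≡ x
⊕-identityˡ = Vecₚ.zipWith-identityˡ ℤₚ.+-identityˡ

⊕-identityʳ : ∀ {n} (x : V n) → x ⊕ 𝟘 ≡ x
⊕-identityʳ = Vecₚ.zipWith-identityʳ ℤₚ.+-identityʳ

•-𝟘 : ∀ {n} c → c • 𝟘 {n} ≡ 𝟘
•-𝟘 {n} c = trans (Vecₚ.map-replicate (c *_) (+ 0) n) (cong (replicate n) (ℤₚ.*-zeroʳ c))

0-• : ∀ {n} (x : V n) → + 0 • x ≡ 𝟘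
0-• []      = refl
0-• (a ∷ x) = cong₂ _∷_ (ℤₚ.*-zeroˡ a) (0-• x)

1-• : ∀ {n} (x : V n) → + 1 • x ≡ x
1-• []      = refl
1-• (a ∷ x) = cong₂ _∷_ (ℤₚ.*-identityˡ a) (1-• x)

•-distribˡ : ∀ {n} c (x y : V n) → c • (x ⊕ y) ≡ c • x ⊕ c • y
•-distribˡ c []      []      = refl
•-distribˡ c (a ∷ x) (b ∷ y) = cong₂ _∷_ (ℤₚ.*-distribˡ-+ c a b) (•-distribˡ c x y)

•-distribʳ : ∀ {n} c d (x : V n) → (c + d) • x ≡ c • x ⊕ d • x
•-distribʳ c d []      = refl
•-distribʳ c d (a ∷ x) = cong₂ _∷_ (ℤₚ.*-distribʳ-+ a c d) (•-distribʳ c d x)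

•-assoc : ∀ {n} c d (x : V n) → (c * d) • x ≡ c • d • x
•-assoc c d []      = refl
•-assoc c d (a ∷ x) = cong₂ _∷_ (ℤₚ.*-assoc c d a) (•-assoc c d x)

•-comm : ∀ {n} c d (x : V n) → c • d • x ≡ d • c • x
•-comm c d x = trans (sym (•-assoc c d x)) (trans (cong (_• x) (ℤₚ.*-comm c d)) (•-assoc d c x))

•-cancel : ∀ {n} c → .{{_ : NonZero c}} → (x y : V n) → c • x ≡ c • y → x ≡ y
•-cancel c []      []      _ = refl
•-cancel c (a ∷ x) (b ∷ y) e =
  cong₂ _∷_ (ℤₚ.*-cancelˡ-≡ c a b (Vecₚ.∷-injectiveˡ e)) (•-cancel c x y (Vecₚ.∷-injectiveʳ e))

⊕-interchange : ∀ {n} (x y z w : V n) → (x ⊕ y) ⊕ (z ⊕ w) ≡ (x ⊕ z) ⊕ (y ⊕ w)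
⊕-interchange []      []      []      []      = refl
⊕-interchange (a ∷ x) (b ∷ y) (c ∷ z) (d ∷ w) = cong₂ _∷_ (e a b c d) (⊕-interchange x y z w)
  where
  e : ∀ a b c d → (a + b) + (c + d) ≡ (a + c) + (b + d)
  e = solve-∀

lookup-⊕ : ∀ {n} (x y : V n) i → lookup (x ⊕ y) i ≡ lookup x i + lookup y i
lookup-⊕ x y i = Vecₚ.lookup-zipWith _+_ i x y

lookup-• : ∀ {n} c (x : V n) i → lookup (c • x) i ≡ c * lookup x i
lookup-• c x i = Vecₚ.lookup-map i (c *_) x

lookup-𝟙 : ∀ {n} (i : Fin n) → lookup (𝟙 i) i ≡ + 1
lookup-𝟙 zero    = refl
lookup-𝟙 (suc i) = lookup-𝟙 i

divisible⇒• : ∀ {n} d (x : V n) → (∀ i → d ∣ lookup x i) → ∃ λ u → x ≡ d • u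
divisible⇒• d []      h = [] , refl
divisible⇒• d (a ∷ x) h with h zero | divisible⇒• d x (λ i → h (suc i))
... | divides q e | u , e′ = q ∷ u , cong₂ _∷_ (trans e (ℤₚ.*-comm q d)) e′

record Linear {n} (f : V n → ℤ) : Set where
  field
    add : ∀ x y → f (x ⊕ y) ≡ f x + f y
    hom : ∀ c x → f (c • x) ≡ c * f x

record LinearMap (n m : ℕ) : Set where
  field
    fun : V n → V m
    add : ∀ x y → fun (x ⊕ y) ≡ fun x ⊕ fun y
    hom : ∀ c x → fun (c • x) ≡ c • fun x

open LinearMap using (fun)

idₗ : ∀ {n} → LinearMap n n
idₗ = record { fun = λ x → x ; add = λ _ _ → refl ; hom = λ _ _ → refl }

infixr 9 _∘ₗ_
_∘ₗ_ : ∀ {n m k} → LinearMap m k → LinearMap n m → LinearMap n k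
g ∘ₗ f = record
  { fun = λ x → fun g (fun f x)
  ; add = λ x y → trans (cong (fun g) (LinearMap.add f x y)) (LinearMap.add g (fun f x) (fun f y))
  ; hom = λ c x → trans (cong (fun g) (LinearMap.hom f c x)) (LinearMap.hom g c (fun f x))
  }

𝟘ₗ : ∀ {n m} → LinearMap n m
𝟘ₗ = record { fun = λ _ → 𝟘 ; add = λ _ _ → sym (⊕-identityˡ 𝟘) ; hom = λ c _ → sym (•-𝟘 c) }

_+ₗ_ : ∀ {n m} → LinearMap n m → LinearMap n m → LinearMap n m
f +ₗ g = record
  { fun = λ x → fun f x ⊕ fun g x
  ; add = λ x y → trans (cong₂ _⊕_ (LinearMap.add f x y) (LinearMap.add g x y))
                        (⊕-interchange (fun f x) (fun f y) (fun g x) (fun g y))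
  ; hom = λ c x → trans (cong₂ _⊕_ (LinearMap.hom f c x) (LinearMap.hom g c x))
                        (sym (•-distribˡ c (fun f x) (fun g x)))
  }

scale : ∀ {n} → ℤ → LinearMap n n
scale c = record { fun = c •_ ; add = •-distribˡ c ; hom = λ d x → •-comm c d x }

rankOne : ∀ {n m} → Fin n → V m → LinearMap n m
rankOne l w = record
  { fun = λ x → lookup x l • w
  ; add = λ x y → trans (cong (_• w) (lookup-⊕ x y l)) (•-distribʳ (lookup x l) (lookup y l) w)
  ; hom = λ c x → trans (cong (_• w) (lookup-• c x l)) (•-assoc c (lookup x l) w)
  }

linear-∷ : ∀ {n} {f : V (suc n) → ℤ} → Linear f → ∀ a x → f (a ∷ x) ≡ a * f (𝟙 zero) + f (+ 0 ∷ x)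
linear-∷ {f = f} lf a x = begin
  f (a ∷ x)                        ≡⟨ cong f (cong₂ _∷_ (alg a) (sym (trans (cong (_⊕ x) (•-𝟘 a)) (⊕-identityˡ x)))) ⟩
  f (a • 𝟙 zero ⊕ (+ 0 ∷ x))       ≡⟨ Linear.add lf (a • 𝟙 zero) (+ 0 ∷ x) ⟩
  f (a • 𝟙 zero) + f (+ 0 ∷ x)     ≡⟨ cong (_+ f (+ 0 ∷ x)) (Linear.hom lf a (𝟙 zero)) ⟩
  a * f (𝟙 zero) + f (+ 0 ∷ x)     ∎
  where
  open ≡-Reasoning
  alg : ∀ a → a ≡ a * + 1 + + 0
  alg = solve-∀

linear-tail : ∀ {n} {f : V (suc n) → ℤ} → Linear f → Linear (λ x → f (+ 0 ∷ x))
linear-tail {f = f} lf = record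
  { add = λ x y → Linear.add lf (+ 0 ∷ x) (+ 0 ∷ y)
  ; hom = λ c x → trans (cong (λ t → f (t ∷ c • x)) (sym (ℤₚ.*-zeroʳ c))) (Linear.hom lf c (+ 0 ∷ x))
  }

linear-ext : ∀ {n} {f : V n → ℤ} → Linear f → (∀ i → f (𝟙 i) ≡ + 0) → ∀ x → f x ≡ + 0
linear-ext {f = f} lf h [] = trans (Linear.hom lf (+ 0) []) (ℤₚ.*-zeroˡ (f []))
linear-ext {f = f} lf h (a ∷ x) = trans (linear-∷ lf a x)
  (cong₂ _+_ (trans (cong (a *_) (h zero)) (ℤₚ.*-zeroʳ a)) (linear-ext (linear-tail lf) (λ i → h (suc i)) x))

-- Cubic maps

∣-resp-≡ : ∀ {d a b} → a ≡ b → d ∣ a → d ∣ b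
∣-resp-≡ refl h = h

∣-self* : ∀ {d} a → d ∣ d * a
∣-self* a = ∣m⇒∣m*n a ∣-refl

∣-*-mono : ∀ {a b c d} → a ∣ b → c ∣ d → a * c ∣ b * d
∣-*-mono {a} {b} {c} {d} (divides q e) (divides q′ e′) =
  divides (q * q′) (trans (cong₂ _*_ e e′) (alg q a q′ c))
  where
  alg : ∀ q a q′ c → (q * a) * (q′ * c) ≡ (q * q′) * (a * c)
  alg = solve-∀

-- The relation is between the cofactors, so that they are coprime even for m = n = 0, where g = 0.
-- `rotate` makes a matrix of determinant 1 out of it.
bezout : ∀ m n → ∃ λ g → ∃ λ a → ∃ λ b → ∃ λ x → ∃ λ y →
  m ≡ a * g × n ≡ b * g × x * a + y * b ≡ + 1
bezout m n with GCD.Bézout.lemma (abs m) (abs n)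
... | GCD.Bézout.result 0 gcd _ =
  + 0 , + 1 , + 0 , + 1 , + 0 ,
  vanish m {+ 1} (proj₁ (GCD.GCD.commonDivisor gcd)) , vanish n {+ 0} (proj₂ (GCD.GCD.commonDivisor gcd)) , refl
  where
  vanish : ∀ i {c} → 0 ℕᵈ.∣ abs i → i ≡ c * + 0
  vanish i {c} h = trans (ℤₚ.∣i∣≡0⇒i≡0 (ℕᵈ.0∣⇒≡0 h)) (sym (ℤₚ.*-zeroʳ c))
... | GCD.Bézout.result d@(suc _) gcd id with
  ∣ᵤ⇒∣ {+ d} {m} (proj₁ (GCD.GCD.commonDivisor gcd)) |
  ∣ᵤ⇒∣ {+ d} {n} (proj₂ (GCD.GCD.commonDivisor gcd)) | ∣m∣∣m {m} | ∣m∣∣m {n} | m∣∣m∣ {m} | m∣∣m∣ {n} | id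
... | divides a ea | divides b eb | _ | _ | divides s es | divides t et | GCD.Bézout.+- x y eq =
  + d , a , b , + x * s , - (+ y * t) , ea , eb ,
  ℤₚ.*-cancelʳ-≡ _ _ (+ d) (begin
    (+ x * s * a + - (+ y * t) * b) * + d   ≡⟨ alg (+ x) s a (+ y) t b (+ d) ⟩
    + x * (s * (a * + d)) - + y * (t * (b * + d)) ≡⟨ cong₂ (λ u v → + x * (s * u) - + y * (t * v)) (sym ea) (sym eb) ⟩
    + x * (s * m) - + y * (t * n)           ≡⟨ cong₂ (λ u v → + x * u - + y * v) (sym es) (sym et) ⟩
    + x * + (abs m) - + y * + (abs n)           ≡⟨ cong₂ _-_ (trans (sym (ℤₚ.pos-* x (abs m))) (trans (cong +_ (sym eq)) (ℤₚ.pos-+ d (y ℕ.* (abs n))))) (sym (ℤₚ.pos-* y (abs n))) ⟩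
    (+ d + + (y ℕ.* (abs n))) - + (y ℕ.* (abs n)) ≡⟨ alg′ (+ d) (+ (y ℕ.* (abs n))) ⟩
    + 1 * + d ∎)
  where
  open ≡-Reasoning
  alg : ∀ x s a y t b d → (x * s * a + - (y * t) * b) * d ≡ x * (s * (a * d)) - y * (t * (b * d))
  alg = solve-∀
  alg′ : ∀ d z → (d + z) - z ≡ + 1 * d
  alg′ = solve-∀
... | divides a ea | divides b eb | _ | _ | divides s es | divides t et | GCD.Bézout.-+ x y eq =
  + d , a , b , - (+ x * s) , + y * t , ea , eb ,
  ℤₚ.*-cancelʳ-≡ _ _ (+ d) (begin
    (- (+ x * s) * a + + y * t * b) * + d   ≡⟨ alg (+ x) s a (+ y) t b (+ d) ⟩
    + y * (t * (b * + d)) - + x * (s * (a * + d)) ≡⟨ cong₂ (λ u v → + y * (t * v) - + x * (s * u)) (sym ea) (sym eb) ⟩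
    + y * (t * n) - + x * (s * m)           ≡⟨ cong₂ (λ u v → + y * v - + x * u) (sym es) (sym et) ⟩
    + y * + (abs n) - + x * + (abs m)           ≡⟨ cong₂ _-_ (trans (sym (ℤₚ.pos-* y (abs n))) (trans (cong +_ (sym eq)) (ℤₚ.pos-+ d (x ℕ.* (abs m))))) (sym (ℤₚ.pos-* x (abs m))) ⟩
    (+ d + + (x ℕ.* (abs m))) - + (x ℕ.* (abs m)) ≡⟨ alg′ (+ d) (+ (x ℕ.* (abs m))) ⟩
    + 1 * + d ∎)
  where
  open ≡-Reasoning
  alg : ∀ x s a y t b d → (- (x * s) * a + y * t * b) * d ≡ y * (t * (b * d)) - x * (s * (a * d))
  alg = solve-∀
  alg′ : ∀ d z → (d + z) - z ≡ + 1 * d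
  alg′ = solve-∀

-- `G x y` is the derivative of `F` at x in direction y. The law `F-⊕` fixes only G x y + G y x; the
-- homogeneity laws tell the two summands apart.
record Cubic (n : ℕ) : Set where
  field
    F     : V n → ℤ
    G     : V n → V n → ℤ
    F-⊕   : ∀ x y → F (x ⊕ y) ≡ F x + G x y + G y x + F y
    F-•   : ∀ c x → F (c • x) ≡ c * (c * c) * F x
    G-⊕ʳ  : ∀ x y z → G x (y ⊕ z) ≡ G x y + G x z
    G-•ˡ  : ∀ c x y → G (c • x) y ≡ c * c * G x y
    G-•ʳ  : ∀ c x y → G x (c • y) ≡ c * G x y

  -- The full polarisation of `F`, with Φ x x x = 6 F x.
  Φ : V n → V n → V n → ℤ
  Φ x y z = G (x ⊕ y) z - G x z - G y z

  -- Expand F (x ⊕ y ⊕ z) in both bracketings and compare. Together with linearity in the last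
  -- argument this makes `Φ` trilinear, although `Cubic` postulates nothing about G (x ⊕ y) z.
  Φ-cyclic : ∀ x y z → Φ x y z ≡ Φ y z x
  Φ-cyclic x y z = begin
    G (x ⊕ y) z - G x z - G y z
      ≡⟨ alg₁ (F x) (F y) (F z) (G x y) (G y x) (G x z) (G z x) (G y z) (G z y) (G (x ⊕ y) z) ⟩
    (F x + G x y + G y x + F y + G (x ⊕ y) z + (G z x + G z y) + F z) - rest
      ≡⟨ cong (_- rest) (trans (sym e₁) e₂) ⟩
    (F x + (G x y + G x z) + G (y ⊕ z) x + (F y + G y z + G z y + F z)) - rest
      ≡⟨ alg₂ (F x) (F y) (F z) (G x y) (G y x) (G x z) (G z x) (G y z) (G z y) (G (y ⊕ z) x) ⟩
    G (y ⊕ z) x - G y x - G z x ∎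
    where
    open ≡-Reasoning
    rest : ℤ
    rest = F x + F y + F z + G x y + G y x + G x z + G z x + G y z + G z y
    e₁ : F ((x ⊕ y) ⊕ z) ≡ F x + G x y + G y x + F y + G (x ⊕ y) z + (G z x + G z y) + F z
    e₁ = trans (F-⊕ (x ⊕ y) z) (cong₂ (λ s t → s + G (x ⊕ y) z + t + F z) (F-⊕ x y) (G-⊕ʳ z x y))
    e₂ : F ((x ⊕ y) ⊕ z) ≡ F x + (G x y + G x z) + G (y ⊕ z) x + (F y + G y z + G z y + F z)
    e₂ = trans (cong F (⊕-assoc x y z)) (trans (F-⊕ x (y ⊕ z))
           (cong₂ (λ s t → F x + s + G (y ⊕ z) x + t) (G-⊕ʳ x y z) (F-⊕ y z)))
    alg₁ : ∀ fx fy fz xy yx xz zx yz zy a → a - xz - yz ≡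
      (fx + xy + yx + fy + a + (zx + zy) + fz) - (fx + fy + fz + xy + yx + xz + zx + yz + zy)
    alg₁ = solve-∀
    alg₂ : ∀ fx fy fz xy yx xz zx yz zy a →
      (fx + (xy + xz) + a + (fy + yz + zy + fz)) - (fx + fy + fz + xy + yx + xz + zx + yz + zy) ≡ a - yx - zx
    alg₂ = solve-∀

  Φ-swap : ∀ x y z → Φ x y z ≡ Φ y x z
  Φ-swap x y z = trans (cong (λ v → G v z - G x z - G y z) (⊕-comm x y)) (alg (G (y ⊕ x) z) (G x z) (G y z))
    where
    alg : ∀ a b c → a - b - c ≡ a - c - b
    alg = solve-∀

  Φ-linear : ∀ x y → Linear (Φ x y)
  Φ-linear x y = record
    { add = λ z w → trans (cong₂ _-_ (cong₂ _-_ (G-⊕ʳ (x ⊕ y) z w) (G-⊕ʳ x z w)) (G-⊕ʳ y z w))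
                          (alg (G (x ⊕ y) z) (G (x ⊕ y) w) (G x z) (G x w) (G y z) (G y w))
    ; hom = λ c z → trans (cong₂ _-_ (cong₂ _-_ (G-•ʳ c (x ⊕ y) z) (G-•ʳ c x z)) (G-•ʳ c y z))
                          (alg′ c (G (x ⊕ y) z) (G x z) (G y z))
    }
    where
    alg : ∀ a b c d e f → (a + b) - (c + d) - (e + f) ≡ (a - c - e) + (b - d - f)
    alg = solve-∀
    alg′ : ∀ c a b d → c * a - c * b - c * d ≡ c * (a - b - d)
    alg′ = solve-∀

  G-⊕ˡ : ∀ x y z → G (x ⊕ y) z ≡ G x z + G y z + Φ x y z
  G-⊕ˡ x y z = alg (G (x ⊕ y) z) (G x z) (G y z)
    where
    alg : ∀ a b c → a ≡ b + c + (a - b - c)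
    alg = solve-∀

  Φ-diagonal : ∀ t x z → Φ (t • x) x z ≡ + 2 * t * G x z
  Φ-diagonal t x z = begin
    G (t • x ⊕ x) z - G (t • x) z - G x z
      ≡⟨ cong₂ (λ a b → a - b - G x z)
           (trans (cong (λ v → G v z) (trans (cong (t • x ⊕_) (sym (1-• x))) (sym (•-distribʳ t (+ 1) x)))) (G-•ˡ (t + + 1) x z))
           (G-•ˡ t x z) ⟩
    (t + + 1) * (t + + 1) * G x z - t * t * G x z - G x z  ≡⟨ alg t (G x z) ⟩
    + 2 * t * G x z ∎
    where
    open ≡-Reasoning
    alg : ∀ t g → (t + + 1) * (t + + 1) * g - t * t * g - g ≡ + 2 * t * g
    alg = solve-∀

  -- Euler's identity: F (x ⊕ x) is 8 F x by homogeneity and 2 F x + 2 G x x by expansion.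
  G-diagonal : ∀ x → G x x ≡ + 3 * F x
  G-diagonal x = ℤₚ.*-cancelˡ-≡ (+ 2) _ _ (begin
    + 2 * G x x                          ≡⟨ alg₁ (F x) (G x x) ⟩
    (F x + G x x + G x x + F x) - + 2 * F x ≡⟨ cong (_- + 2 * F x) (sym (F-⊕ x x)) ⟩
    F (x ⊕ x) - + 2 * F x                ≡⟨ cong (λ v → F v - + 2 * F x) (trans (sym (cong₂ _⊕_ (1-• x) (1-• x))) (sym (•-distribʳ (+ 1) (+ 1) x))) ⟩
    F (+ 2 • x) - + 2 * F x              ≡⟨ cong (_- + 2 * F x) (F-• (+ 2) x) ⟩
    + 2 * (+ 2 * + 2) * F x - + 2 * F x  ≡⟨ alg₂ (F x) ⟩
    + 2 * (+ 3 * F x) ∎)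
    where
    open ≡-Reasoning
    alg₁ : ∀ f g → + 2 * g ≡ (f + g + g + f) - + 2 * f
    alg₁ = solve-∀
    alg₂ : ∀ f → + 2 * (+ 2 * + 2) * f - + 2 * f ≡ + 2 * (+ 3 * f)
    alg₂ = solve-∀

open Cubic

pullback : ∀ {n m} → Cubic m → LinearMap n m → Cubic n
pullback C f = record
  { F    = λ x → F C (fun f x)
  ; G    = λ x y → G C (fun f x) (fun f y)
  ; F-⊕  = λ x y → trans (cong (F C) (LinearMap.add f x y)) (F-⊕ C (fun f x) (fun f y))
  ; F-•  = λ c x → trans (cong (F C) (LinearMap.hom f c x)) (F-• C c (fun f x))
  ; G-⊕ʳ = λ x y z → trans (cong (G C (fun f x)) (LinearMap.add f y z)) (G-⊕ʳ C (fun f x) (fun f y) (fun f z))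
  ; G-•ˡ = λ c x y → trans (cong (λ v → G C v (fun f y)) (LinearMap.hom f c x)) (G-•ˡ C c (fun f x) (fun f y))
  ; G-•ʳ = λ c x y → trans (cong (G C (fun f x)) (LinearMap.hom f c y)) (G-•ʳ C c (fun f x) (fun f y))
  }

module Division {n} (C : Cubic n) (d : ℤ) .{{d≢0 : NonZero d}}
  (d∣F : ∀ x → d ∣ F C x) (d∣G : ∀ x y → d ∣ G C x y) where

  private
    q : V n → ℤ
    q x = quotient (d∣F x)
    r : V n → V n → ℤ
    r x y = quotient (d∣G x y)

  F≡ : ∀ x → F C x ≡ q x * d
  F≡ x = _∣_.equality (d∣F x)
  G≡ : ∀ x y → G C x y ≡ r x y * d
  G≡ x y = _∣_.equality (d∣G x y)

  private
    cancel : ∀ {a b} → a * d ≡ b * d → a ≡ b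
    cancel {a} {b} = ℤₚ.*-cancelʳ-≡ a b d

    cancel-hom : ∀ c {a b A B} → A ≡ a * d → B ≡ b * d → A ≡ c * B → a ≡ c * b
    cancel-hom c {a} {b} A≡ B≡ h =
      cancel (trans (sym A≡) (trans h (trans (cong (c *_) B≡) (sym (ℤₚ.*-assoc c b d)))))

  -- The laws of `Cubic` are linear in the pair (F , G), so the common factor `d` cancels from each.
  divided : Cubic n
  divided = record
    { F    = q
    ; G    = r
    ; F-⊕  = λ x y → cancel (trans (sym (F≡ (x ⊕ y))) (trans (F-⊕ C x y)
               (trans (cong₂ _+_ (cong₂ _+_ (cong₂ _+_ (F≡ x) (G≡ x y)) (G≡ y x)) (F≡ y))
                      (alg (q x) (r x y) (r y x) (q y) d))))
    ; F-•  = λ c x → cancel-hom (c * (c * c)) (F≡ (c • x)) (F≡ x) (F-• C c x)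
    ; G-⊕ʳ = λ x y z → cancel (trans (sym (G≡ x (y ⊕ z))) (trans (G-⊕ʳ C x y z)
               (trans (cong₂ _+_ (G≡ x y) (G≡ x z)) (sym (ℤₚ.*-distribʳ-+ d (r x y) (r x z))))))
    ; G-•ˡ = λ c x y → cancel-hom (c * c) (G≡ (c • x) y) (G≡ x y) (G-•ˡ C c x y)
    ; G-•ʳ = λ c x y → cancel-hom c (G≡ x (c • y)) (G≡ x y) (G-•ʳ C c x y)
    }
    where
    alg : ∀ a b c e d → a * d + b * d + c * d + e * d ≡ (a + b + c + e) * d
    alg = solve-∀

-- Chevalley's theorem for cubic maps

difference : ∀ {n} → V n → (V n → ℤ) → V n → ℤ
difference h f x = f (x ⊕ h) - f x

-- "f has degree less than d", in the sense that all d-fold differences vanish.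
data Deg< {n} : ℕ → (V n → ℤ) → Set where
  vanishes : ∀ {f} → (∀ x → f x ≡ + 0) → Deg< zero f
  differs  : ∀ {d f} → (∀ h → Deg< d (difference h f)) → Deg< (suc d) f

Deg<-cong : ∀ {n d} {f g : V n → ℤ} → (∀ x → f x ≡ g x) → Deg< d f → Deg< d g
Deg<-cong e (vanishes f≡0) = vanishes (λ x → trans (sym (e x)) (f≡0 x))
Deg<-cong e (differs df)   = differs (λ h → Deg<-cong (λ x → cong₂ _-_ (e (x ⊕ h)) (e x)) (df h))

Deg<-zero : ∀ {n} d {f : V n → ℤ} → (∀ x → f x ≡ + 0) → Deg< d f
Deg<-zero zero    f≡0 = vanishes f≡0
Deg<-zero (suc d) f≡0 = differs (λ h → Deg<-zero d (λ x → cong₂ _-_ (f≡0 (x ⊕ h)) (f≡0 x)))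

Deg<-mono : ∀ {n d e} {f : V n → ℤ} → d ℕ.≤ e → Deg< d f → Deg< e f
Deg<-mono {e = e} z≤n (vanishes f≡0) = Deg<-zero e f≡0
Deg<-mono (s≤s d≤e)   (differs df)   = differs (λ h → Deg<-mono d≤e (df h))

Deg<-+ : ∀ {n d} {f g : V n → ℤ} → Deg< d f → Deg< d g → Deg< d (λ x → f x + g x)
Deg<-+ (vanishes f≡0) (vanishes g≡0) = vanishes (λ x → cong₂ _+_ (f≡0 x) (g≡0 x))
Deg<-+ {f = f} {g} (differs df) (differs dg) = differs (λ h →
  Deg<-cong (λ x → alg (f (x ⊕ h)) (f x) (g (x ⊕ h)) (g x)) (Deg<-+ (df h) (dg h)))
  where
  alg : ∀ a b c d → (a - b) + (c - d) ≡ (a + c) - (b + d)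
  alg = solve-∀

Deg<-shift : ∀ {n d} {f : V n → ℤ} h → Deg< d f → Deg< d (λ x → f (x ⊕ h))
Deg<-shift h (vanishes f≡0) = vanishes (λ x → f≡0 (x ⊕ h))
Deg<-shift {f = f} h (differs df) = differs (λ k →
  Deg<-cong (λ x → cong (λ v → f v - f (x ⊕ h)) (swap x k)) (Deg<-shift h (df k)))
  where
  swap : ∀ x k → (x ⊕ h) ⊕ k ≡ (x ⊕ k) ⊕ h
  swap x k = trans (⊕-assoc x h k) (trans (cong (x ⊕_) (⊕-comm h k)) (sym (⊕-assoc x k h)))

Deg<-pullback : ∀ {n m d} {f : V m → ℤ} (ι : LinearMap n m) → Deg< d f → Deg< d (λ x → f (fun ι x))
Deg<-pullback ι (vanishes f≡0) = vanishes (λ x → f≡0 (fun ι x))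
Deg<-pullback {f = f} ι (differs df) = differs (λ h →
  Deg<-cong (λ x → cong (λ v → f v - f (fun ι x)) (sym (LinearMap.add ι x h)))
    (Deg<-pullback ι (df (fun ι h))))

-- Discrete Leibniz rule: the difference of f g is Δf times the shifted g, plus f times Δg. The two
-- auxiliary versions admit the bound zero for one factor, which occurs once its difference
-- vanishes.
Deg<-*  : ∀ {n} a b {f g : V n → ℤ} →
  Deg< (suc a) f → Deg< (suc b) g → Deg< (suc (a ℕ.+ b)) (λ x → f x * g x)
Deg<-*ˡ : ∀ {n} a b {f g : V n → ℤ} →
  Deg< a f → Deg< (suc b) g → Deg< (a ℕ.+ b) (λ x → f x * g x)
Deg<-*ʳ : ∀ {n} a b {f g : V n → ℤ} →
  Deg< (suc a) f → Deg< b g → Deg< (a ℕ.+ b) (λ x → f x * g x)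

Deg<-* a b {f} {g} df@(differs Δf) dg@(differs Δg) = differs (λ h →
  Deg<-cong (λ x → alg (f (x ⊕ h)) (f x) (g (x ⊕ h)) (g x))
    (Deg<-+ (Deg<-*ˡ a b (Δf h) (Deg<-shift h dg)) (Deg<-*ʳ a b df (Δg h))))
  where
  alg : ∀ a b c d → (a - b) * c + b * (c - d) ≡ a * c - b * d
  alg = solve-∀
Deg<-*ˡ zero    b {g = g} (vanishes f≡0) dg =
  Deg<-zero b (λ x → trans (cong (_* g x) (f≡0 x)) (ℤₚ.*-zeroˡ (g x)))
Deg<-*ˡ (suc a) b df dg = Deg<-* a b df dg
Deg<-*ʳ a zero    {f = f} df (vanishes g≡0) =
  Deg<-zero (a ℕ.+ 0) (λ x → trans (cong (f x *_) (g≡0 x)) (ℤₚ.*-zeroʳ (f x)))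
Deg<-*ʳ a (suc b) {f} {g} df dg =
  subst (λ d → Deg< d (λ x → f x * g x)) (sym (ℕₚ.+-suc a b)) (Deg<-* a b df dg)

difference^ : ∀ {n} → ℕ → V n → (V n → ℤ) → V n → ℤ
difference^ zero    h f = f
difference^ (suc k) h f = difference^ k h (difference h f)

Deg<-difference^ : ∀ {n} k d {f : V n → ℤ} h → Deg< (k ℕ.+ d) f → Deg< d (difference^ k h f)
Deg<-difference^ zero    d h df = df
Deg<-difference^ (suc k) d h (differs df) = Deg<-difference^ k d h (df h)

⊕-next : ∀ {n} (x h : V n) t → (x ⊕ + t • h) ⊕ h ≡ x ⊕ + suc t • h
⊕-next []      []      t = refl
⊕-next (a ∷ x) (b ∷ h) t = cong₂ _∷_ (alg a b (+ t)) (⊕-next x h t)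
  where
  alg : ∀ a b t → (a + t * b) + b ≡ a + (+ 1 + t) * b
  alg = solve-∀

∤-difference : ∀ {d a b} → ¬ d ∣ a - b → ¬ d ∣ a ⊎ ¬ d ∣ b
∤-difference {d} {a} {b} h with d ∣? a | d ∣? b
... | yes u | yes v = ⊥-elim (h (∣m∣n⇒∣m-n u v))
... | no ¬u | _     = inj₁ ¬u
... | _     | no ¬v = inj₂ ¬v

difference^-support : ∀ {n} d k h (f : V n → ℤ) x → ¬ d ∣ difference^ k h f x → ∃ λ t → ¬ d ∣ f (x ⊕ + t • h)
difference^-support d zero    h f x ∤f =
  0 , subst (λ v → ¬ d ∣ f v) (sym (trans (cong (x ⊕_) (0-• h)) (⊕-identityʳ x))) ∤f
difference^-support d (suc k) h f x ∤Δ with difference^-support d k h (difference h f) x ∤Δ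
... | t , ∤Δf with ∤-difference ∤Δf
...   | inj₁ ∤f = suc t , subst (λ v → ¬ d ∣ f v) (⊕-next x h t) ∤f
...   | inj₂ ∤f = t , ∤f

-- As long as f (x ⊕ h) vanishes modulo d, the difference at x is -f x modulo d and remains
-- non-zero; the first failure is a point as desired.
difference^-origin : ∀ {n} d k h (f : V n → ℤ) x → ¬ d ∣ f x →
  (∃ λ t → 0 < t × t ℕ.≤ k × ¬ d ∣ f (x ⊕ + t • h)) ⊎ ¬ d ∣ difference^ k h f x
difference^-origin d zero    h f x ∤f = inj₂ ∤f
difference^-origin d (suc k) h f x ∤f with d ∣? f (x ⊕ h)
... | no ∤f′ = inj₁ (1 , s≤s z≤n , s≤s z≤n , subst (λ v → ¬ d ∣ f (x ⊕ v)) (sym (1-• h)) ∤f′)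
... | yes ∣f′ with difference^-origin d k h (difference h f) x
                     (λ ∣Δ → ∤f (∣-resp-≡ (alg (f (x ⊕ h)) (f x)) (∣m∣n⇒∣m-n ∣f′ ∣Δ)))
  where
  alg : ∀ a b → a - (a - b) ≡ b
  alg = solve-∀
...   | inj₂ ∤Δ = inj₂ ∤Δ
...   | inj₁ (t , 0<t , t≤k , ∤Δf) with ∤-difference ∤Δf
...     | inj₁ ∤f′ = inj₁ (suc t , s≤s z≤n , s≤s t≤k , subst (λ v → ¬ d ∣ f v) (⊕-next x h t) ∤f′)
...     | inj₂ ∤f′ = inj₁ (t , 0<t , ℕₚ.m≤n⇒m≤1+n t≤k , ∤f′)

prepend0 : ∀ {n} → LinearMap n (suc n)
prepend0 = record
  { fun = + 0 ∷_
  ; add = λ _ _ → refl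
  ; hom = λ c x → cong (_∷ c • x) (sym (ℤₚ.*-zeroʳ c))
  }

∤-small : ∀ {k t} → 0 < t → t ℕ.≤ k → ¬ + suc k ∣ + t
∤-small {t = suc _} 0<t t≤k h = ℕₚ.<⇒≱ (s≤s t≤k) (ℕᵈ.∣⇒≤ (∣⇒∣ᵤ h))

-- Taking k-fold differences in every coordinate direction kills f, yet expresses f 𝟘, up to
-- sign, through the values of f at the other points of the box {0,…,k}ⁿ.
nonzero-point : ∀ {n} k (f : V n → ℤ) → Deg< (n ℕ.* k) f → ¬ + suc k ∣ f 𝟘 →
  ∃ λ x → (∃ λ i → ¬ + suc k ∣ lookup x i) × ¬ + suc k ∣ f x
nonzero-point {zero} k f (vanishes f≡0) ∤f = ⊥-elim (∤f (∣-resp-≡ (sym (f≡0 [])) (divides (+ 0) refl)))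
nonzero-point {suc n} k f df ∤f with difference^-origin (+ suc k) k (𝟙 zero) f 𝟘 ∤f
... | inj₁ (t , 0<t , t≤k , ∤f′) =
  (𝟘 ⊕ + t • 𝟙 zero) , (zero , λ h → ∤-small 0<t t≤k (∣-resp-≡ (alg (+ t)) h)) , ∤f′
  where
  alg : ∀ t → + 0 + t * + 1 ≡ t
  alg = solve-∀
... | inj₂ ∤Δ with nonzero-point k (λ y → difference^ k (𝟙 zero) f (+ 0 ∷ y))
                    (Deg<-pullback prepend0 (Deg<-difference^ k (n ℕ.* k) (𝟙 zero) df)) ∤Δ
-- The first coordinate found here may be any t: non-triviality rests on a coordinate of y, which
-- shifts along `𝟙 zero` do not touch.
...   | y , (i , ∤yᵢ) , ∤g with difference^-support (+ suc k) k (𝟙 zero) f (+ 0 ∷ y) ∤g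
...     | t , ∤f′ = ((+ 0 ∷ y) ⊕ + t • 𝟙 zero) ,
  (suc i , λ h → ∤yᵢ (∣-resp-≡ (cong (λ v → lookup v i) (trans (cong (y ⊕_) (•-𝟘 (+ t))) (⊕-identityʳ y))) h)) , ∤f′

const-Deg< : ∀ {n} c → Deg< {n} 1 (λ _ → c)
const-Deg< c = differs (λ h → vanishes (λ x → ℤₚ.+-inverseʳ c))

linear-Deg< : ∀ {n} {f : V n → ℤ} → Linear f → Deg< 2 f
linear-Deg< {f = f} lf = differs (λ h →
  Deg<-cong (λ x → sym (trans (cong (_- f x) (Linear.add lf x h)) (alg (f x) (f h)))) (const-Deg< (f h)))
  where
  alg : ∀ a b → (a + b) - a ≡ b
  alg = solve-∀

G-linear : ∀ {n} (C : Cubic n) x → Linear (G C x)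
G-linear C x = record { add = G-⊕ʳ C x ; hom = λ c → G-•ʳ C c x }

Gˡ-Deg< : ∀ {n} (C : Cubic n) y → Deg< 3 (λ x → G C x y)
Gˡ-Deg< C y = differs (λ h →
  Deg<-cong (λ x → sym (trans (cong (_- G C x y) (G-⊕ˡ C x h y))
                       (trans (cong (λ t → G C x y + G C h y + t - G C x y) (Φ-cyclic C x h y))
                              (alg (G C x y) (G C h y) (Φ C h y x)))))
    (Deg<-+ (Deg<-mono (s≤s z≤n) (const-Deg< (G C h y))) (linear-Deg< (Φ-linear C h y))))
  where
  alg : ∀ a b c → a + b + c - a ≡ b + c
  alg = solve-∀

F-Deg< : ∀ {n} (C : Cubic n) → Deg< 4 (F C)
F-Deg< C = differs (λ h →
  Deg<-cong (λ x → sym (trans (cong (_- F C x) (F-⊕ C x h)) (alg (F C x) (G C x h) (G C h x) (F C h))))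
    (Deg<-+ (Deg<-+ (Gˡ-Deg< C h) (Deg<-mono (s≤s (s≤s z≤n)) (linear-Deg< (G-linear C h))))
            (Deg<-mono (s≤s z≤n) (const-Deg< (F C h)))))
  where
  alg : ∀ a b c d → a + b + c + d - a ≡ b + c + d
  alg = solve-∀

F-𝟘 : ∀ {n} (C : Cubic n) → F C 𝟘 ≡ + 0
F-𝟘 C = trans (cong (F C) (sym (0-• 𝟘))) (trans (F-• C (+ 0) 𝟘) (ℤₚ.*-zeroˡ (F C 𝟘)))

-- (a - 1)(a - 2)...(a - j). For j = p - 1 it is prime to p exactly when p divides a, and so takes
-- the place of 1 - a^(p - 1) in the usual proof of Chevalley's theorem.
fallingProduct : ℕ → ℤ → ℤ
fallingProduct zero    a = + 1
fallingProduct (suc j) a = (a + -[1+ j ]) * fallingProduct j a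

fallingProduct-Deg< : ∀ {n d} {f : V n → ℤ} j → Deg< (suc d) f → Deg< (suc (j ℕ.* d)) (λ x → fallingProduct j (f x))
fallingProduct-Deg< zero    df = const-Deg< (+ 1)
fallingProduct-Deg< {d = d} {f} (suc j) (differs df) = Deg<-* d (j ℕ.* d)
  {λ x → f x + -[1+ j ]} {λ x → fallingProduct j (f x)}
  (differs (λ h → Deg<-cong (λ x → alg (f (x ⊕ h)) (f x) -[1+ j ]) (df h))) (fallingProduct-Deg< j (differs df))
  where
  alg : ∀ a b c → a - b ≡ (a + c) - (b + c)
  alg = solve-∀

factor∣fallingProduct : ∀ {j i} a → i < j → (a + -[1+ i ]) ∣ fallingProduct j a
factor∣fallingProduct {suc j} a (s≤s i≤j) with ℕₚ.m≤n⇒m<n∨m≡n i≤j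
... | inj₁ i<j  = ∣n⇒∣m*n (a + -[1+ j ]) (factor∣fallingProduct a i<j)
... | inj₂ refl = ∣m⇒∣m*n (fallingProduct j a) ∣-refl

euclid : ∀ {p a b} → Prime p → + p ∣ a * b → + p ∣ a ⊎ + p ∣ b
euclid {p} {a} {b} pr h with euclidsLemma (abs a) (abs b) pr (subst (p ℕᵈ.∣_) (ℤₚ.abs-* a b) (∣⇒∣ᵤ h))
... | inj₁ u = inj₁ (∣ᵤ⇒∣ u)
... | inj₂ v = inj₂ (∣ᵤ⇒∣ v)

-- The value at 0 is j! up to sign, and the prime k + 1 exceeds all its factors.
fallingProduct-0 : ∀ k j → Prime (suc k) → j ℕ.≤ k → ¬ + suc k ∣ fallingProduct j (+ 0)
fallingProduct-0 (suc k) zero    pr j≤k h = ∤-small (s≤s z≤n) (s≤s z≤n) h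
fallingProduct-0 zero    zero    pr j≤k h = ⊥-elim (ℕ.NonTrivial.nonTrivial (prime⇒nonTrivial pr))
fallingProduct-0 k (suc j) pr j≤k h with euclid pr h
... | inj₁ u = ∤-small {k} {suc j} (s≤s z≤n) j≤k (∣m⇒∣-m u)
... | inj₂ v = fallingProduct-0 k j pr (ℕₚ.<⇒≤ j≤k) v

fallingProduct-root : ∀ k a → ¬ + suc k ∣ fallingProduct k a → + suc k ∣ a
fallingProduct-root k a ∤h with a ℤᵈ.%ℕ suc k | ℤᵈ.n%ℕd<d a (suc k) | ℤᵈ.a≡a%ℕn+[a/ℕn]*n a (suc k)
... | zero  | _       | e = divides (a ℤᵈ./ℕ suc k) (trans e (ℤₚ.+-identityˡ _))
... | suc i | s≤s i<k | e = ⊥-elim (∤h (∣-trans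
  (divides (a ℤᵈ./ℕ suc k) (trans (cong (_- + suc i) e) (alg (+ suc i) (a ℤᵈ./ℕ suc k * + suc k))))
  (factor∣fallingProduct a i<k)))
  where
  alg : ∀ a b → (a + b) - a ≡ b
  alg = solve-∀

opaque
  -- The falling product of F has degree at most 3 (p - 1), less than the 4 (p - 1) that
  -- `nonzero-point` has at its disposal, and it is prime to p at the origin. Hence it is prime to p
  -- at a second point, which must be a zero of F modulo p.
  chevalley : ∀ {n p} → Prime p → (C : Cubic (4 ℕ.+ n)) →
    ∃ λ x → (∃ λ i → ¬ + p ∣ lookup x i) × + p ∣ F C x
  chevalley {n} {zero}  pr C = ⊥-elim (ℕ.≢-nonZero⁻¹ 0 {{prime⇒nonZero pr}} refl)
  chevalley {n} {suc k} pr C =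
    let x , unit , ∤h = nonzero-point k (λ x → fallingProduct k (F C x))
          (Deg<-mono bound (fallingProduct-Deg< k (F-Deg< C)))
          (λ h → fallingProduct-0 k k pr ℕₚ.≤-refl (∣-resp-≡ (cong (fallingProduct k) (F-𝟘 C)) h))
    in x , unit , fallingProduct-root k (F C x) ∤h
    where
    open ℕₚ.≤-Reasoning
    bound : suc (k ℕ.* 3) ℕ.≤ (4 ℕ.+ n) ℕ.* k
    bound = begin
      suc (k ℕ.* 3)        ≤⟨ ℕₚ.+-monoˡ-≤ (k ℕ.* 3) (ℕₚ.≤-pred (ℕ.nonTrivial⇒n>1 (suc k) {{prime⇒nonTrivial pr}})) ⟩
      k ℕ.+ k ℕ.* 3        ≡⟨ cong (k ℕ.+_) (ℕₚ.*-comm k 3) ⟩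
      4 ℕ.* k              ≤⟨ ℕₚ.*-monoˡ-≤ k (ℕₚ.m≤m+n 4 n) ⟩
      (4 ℕ.+ n) ℕ.* k      ∎

-- Smooth points and sublattices

opaque
  unit-inverse : ∀ {p c} → Prime p → ¬ + p ∣ c → ∃ λ u → ∃ λ t → u * c + t * + p ≡ + 1
  unit-inverse {p} {c} pr ∤c with bezout c (+ p)
  ... | g , a , b , x , y , c≡ , p≡ , xa+yb≡1 with prime⇒irreducible pr (∣⇒∣ᵤ {g} {+ p} (divides b p≡))
  ...   | inj₂ g≡p = ⊥-elim (∤c (∣-trans (∣ᵤ⇒∣ (subst (ℕᵈ._∣ abs g) g≡p ℕᵈ.∣-refl)) (divides a c≡)))
  ...   | inj₁ g≡1 = x * g , y * g , (begin
    x * g * c + y * g * + p              ≡⟨ cong₂ (λ s t → x * g * s + y * g * t) c≡ p≡ ⟩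
    x * g * (a * g) + y * g * (b * g)    ≡⟨ alg x a y b g ⟩
    (x * a + y * b) * (g * g)            ≡⟨ cong₂ _*_ xa+yb≡1 (square g g≡1) ⟩
    + 1                                  ∎)
    where
    open ≡-Reasoning
    alg : ∀ x a y b g → x * g * (a * g) + y * g * (b * g) ≡ (x * a + y * b) * (g * g)
    alg = solve-∀
    square : ∀ g → abs g ≡ 1 → g * g ≡ + 1
    square (+ 1)    refl = refl
    square -[1+ 0 ] refl = refl

-- Here `d` is pᵏ and `π` is p; divisibility on ℤx + ℤy is expressed by the four coefficients of F
-- (s x + t y).
record SmoothPoint {n} (C : Cubic n) (d π : ℤ) (x y : V n) : Set where
  field
    ∣Gxy   : d ∣ G C x y
    ∣Gyx   : d ∣ G C y x
    ∣Fy    : d ∣ F C y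
    zero-x : d * π ∣ F C x
    unit-G : ¬ d * π ∣ G C x y

NoSmoothPoint : ∀ {n} → Cubic n → ℤ → ℤ → Set
NoSmoothPoint C d π = ∀ x y → ¬ SmoothPoint C d π x y

record Level {n} (C : Cubic n) (d : ℤ) (L : V n → Set) : Set where
  field
    L-⊕  : ∀ {x y} → L x → L y → L (x ⊕ y)
    L-•  : ∀ c {x} → L x → L (c • x)
    L⇒∣F : ∀ {x} → L x → d ∣ F C x
    L⇒∣G : ∀ {x y} → L x → L y → d ∣ G C x y

open Level

module NextLevel {n} {C : Cubic n} {d π : ℤ} {L : V n → Set} (lev : Level C d L) (singular : NoSmoothPoint C d π) where

  d∣dπ : ∀ {a} → d * π ∣ a → d ∣ a
  d∣dπ = ∣-trans (∣-self* π)

  Next : V n → Set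
  Next x = L x × d * π ∣ F C x

  -- Otherwise x and y would form a smooth point. This is what turns the zeros of F modulo d π into
  -- a lattice: the mixed terms of F (x ⊕ y) vanish.
  Next⇒∣G : ∀ {x y} → Next x → L y → d * π ∣ G C x y
  Next⇒∣G {x} {y} (Lx , ∣Fx) Ly = decidable-stable (d * π ∣? G C x y) λ ∤G →
    singular x y record
      { ∣Gxy = L⇒∣G lev Lx Ly ; ∣Gyx = L⇒∣G lev Ly Lx ; ∣Fy = L⇒∣F lev Ly
      ; zero-x = ∣Fx ; unit-G = ∤G }

  next : Level C (d * π) Next
  next = record
    { L-⊕  = λ {x} {y} Nx@(Lx , ∣Fx) Ny@(Ly , ∣Fy) → L-⊕ lev Lx Ly ,
        ∣-resp-≡ (sym (F-⊕ C x y)) (∣m∣n⇒∣m+n (∣m∣n⇒∣m+n (∣m∣n⇒∣m+n ∣Fx (Next⇒∣G Nx Ly)) (Next⇒∣G Ny Lx)) ∣Fy)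
    ; L-•  = λ c {x} (Lx , ∣Fx) → L-• lev c Lx , ∣-resp-≡ (sym (F-• C c x)) (∣n⇒∣m*n (c * (c * c)) ∣Fx)
    ; L⇒∣F = proj₂
    ; L⇒∣G = λ Nx (Ly , _) → Next⇒∣G Nx Ly
    }

_∣ᵥ_ : ∀ {n} → ℤ → V n → Set
d ∣ᵥ x = ∀ i → d ∣ lookup x i

insertZero : ∀ {n} → Fin (suc n) → LinearMap n (suc n)
insertZero i = record { fun = λ x → insertAt x i (+ 0) ; add = add i ; hom = hom i }
  where
  add : ∀ {n} (i : Fin (suc n)) (x y : V n) → insertAt (x ⊕ y) i (+ 0) ≡ insertAt x i (+ 0) ⊕ insertAt y i (+ 0)
  add zero    x       y       = refl
  add (suc i) (a ∷ x) (b ∷ y) = cong (a + b ∷_) (add i x y)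
  hom : ∀ {n} (i : Fin (suc n)) c (x : V n) → insertAt (c • x) i (+ 0) ≡ c • insertAt x i (+ 0)
  hom zero    c x       = cong (_∷ c • x) (sym (ℤₚ.*-zeroʳ c))
  hom (suc i) c (a ∷ x) = cong (c * a ∷_) (hom i c x)

tailₗ : ∀ {n} → LinearMap (suc n) n
tailₗ = record { fun = tail ; add = λ { (_ ∷ _) (_ ∷ _) → refl } ; hom = λ { _ (_ ∷ _) → refl } }

-- Injectivity modulo d; for a prime d, linear independence of the columns modulo d.
Reflects : ∀ {n m} → ℤ → LinearMap n m → Set
Reflects d f = ∀ x → d ∣ᵥ fun f x → d ∣ᵥ x

module _ {p r} (pr : Prime p) {C : Cubic r} {d : ℤ} {{d≢0 : NonZero d}} {L : V r → Set} (lev : Level C d L) where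

  private
    π : ℤ
    π = + p

  zero-in-span : ∀ {n} (f : LinearMap (4 ℕ.+ n) r) → (∀ x → L (fun f x)) →
    ∃ λ c → (∃ λ i → ¬ π ∣ lookup c i) × d * π ∣ F C (fun f c)
  zero-in-span f Lf with chevalley pr divided
    where open Division (pullback C f) d (λ x → L⇒∣F lev (Lf x)) (λ x y → L⇒∣G lev (Lf x) (Lf y))
  ... | c , unit , ∣F = c , unit ,
    ∣-resp-≡ (trans (ℤₚ.*-comm d _) (sym (F≡ c))) (*-monoʳ-∣ d ∣F)
    where open Division (pullback C f) d (λ x → L⇒∣F lev (Lf x)) (λ x y → L⇒∣G lev (Lf x) (Lf y))

  -- Zeros are split off one by one. After a zero c whose coordinate i is a unit, the search goes on
  -- among vectors with coordinate i equal to 0, which keeps the later zeros independent of c modulo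
  -- p. It can continue while four variables remain.
  zeros-of-corank-3 : ∀ {n} (f : LinearMap (3 ℕ.+ n) r) → (∀ x → L (fun f x)) →
    (∀ {x y} → L x × d * π ∣ F C x → L y × d * π ∣ F C y → d * π ∣ F C (x ⊕ y)) →
    ∃ λ (g : LinearMap n (3 ℕ.+ n)) → Reflects π g × (∀ x → d * π ∣ F C (fun f (fun g x)))
  zeros-of-corank-3 {zero}  f Lf closed = 𝟘ₗ , (λ x _ ()) , λ x →
    ∣-resp-≡ (sym (trans (cong (F C) (trans (cong (fun f) (sym (0-• 𝟘))) (trans (LinearMap.hom f (+ 0) 𝟘) (0-• (fun f 𝟘))))) (F-𝟘 C))) (divides (+ 0) refl)
  zeros-of-corank-3 {suc n} f Lf closed with zero-in-span f Lf
  ... | c , (i , ∤cᵢ) , ∣Fc with zeros-of-corank-3 (f ∘ₗ insertZero i) (λ x → Lf (insertAt x i (+ 0))) closed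
  ...   | g , g-reflects , ∣Fg = h , h-reflects , ∣Fh
    where
    h : LinearMap (suc n) (4 ℕ.+ n)
    h = rankOne zero c +ₗ (insertZero i ∘ₗ g ∘ₗ tailₗ)
    ∣Fh : ∀ x → d * π ∣ F C (fun f (fun h x))
    ∣Fh (a ∷ x) = ∣-resp-≡ (cong (F C) (sym (LinearMap.add f (a • c) (insertAt (fun g x) i (+ 0)))))
      (closed (Lf (a • c) , ∣-resp-≡ (sym (trans (cong (F C) (LinearMap.hom f a c)) (F-• C a (fun f c)))) (∣n⇒∣m*n (a * (a * a)) ∣Fc))
              (Lf (insertAt (fun g x) i (+ 0)) , ∣Fg x))
    h-reflects : Reflects π h
    h-reflects (a ∷ x) ∣h = λ { zero → ∣a ; (suc j) → g-reflects x ∣gx j }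
      where
      y : V (4 ℕ.+ n)
      y = insertAt (fun g x) i (+ 0)
      ∣a : π ∣ a
      ∣a with euclid pr (∣-resp-≡ (trans (lookup-⊕ (a • c) y i) (trans (cong₂ _+_ (lookup-• a c i) (Vecₚ.insertAt-lookup (fun g x) i (+ 0))) (ℤₚ.+-identityʳ _))) (∣h i))
      ... | inj₁ u = u
      ... | inj₂ v = ⊥-elim (∤cᵢ v)
      ∣y : π ∣ᵥ y
      ∣y j = ∣m+n∣m⇒∣n (∣-resp-≡ (lookup-⊕ (a • c) y j) (∣h j)) (∣-resp-≡ (sym (lookup-• a c j)) (∣m⇒∣m*n (lookup c j) ∣a))
      ∣gx : π ∣ᵥ fun g x
      ∣gx j = ∣-resp-≡ (Vecₚ.insertAt-punchIn (fun g x) i (+ 0) j) (∣y (Fin.punchIn i j))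

  opaque
    zeros-in-Next : NoSmoothPoint C d π → ∀ {n} (f : LinearMap (3 ℕ.+ n) r) → (∀ x → L (fun f x)) →
      ∃ λ (g : LinearMap n (3 ℕ.+ n)) → Reflects π g × (∀ x → L (fun f (fun g x)) × d * π ∣ F C (fun f (fun g x)))
    zeros-in-Next singular f Lf =
      let g , reflects , ∣F = zeros-of-corank-3 f Lf (λ Nx Ny → proj₂ (L-⊕ (NextLevel.next lev singular) Nx Ny))
      in g , reflects , λ x → Lf (fun g x) , ∣F x

-- Enlarging the lattice

-- The new factor stands on the right, so that `pow p 1` and `pow p 2` reduce to the scales
-- `+ 1 * + p` and `+ 1 * + p * + p` of `refine`.
pow : ℕ → ℕ → ℤ
pow p zero    = + 1
pow p (suc k) = pow p k * + p

+p-nonZero : ∀ {p} → Prime p → NonZero (+ p)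
+p-nonZero {zero}  pr = prime⇒nonZero pr
+p-nonZero {suc p} pr = _

pow-nonZero : ∀ {p} → Prime p → ∀ k → NonZero (pow p k)
pow-nonZero pr zero    = _
pow-nonZero {p} pr (suc k) = ℤₚ.i*j≢0 (pow p k) (+ p) {{pow-nonZero pr k}} {{+p-nonZero pr}}

-- In the coordinates of a larger lattice the form is C′; S includes the old lattice and T maps
-- p times the new lattice back into it.
record Refinement {n} (p : ℕ) (C : Cubic n) : Set where
  field
    C′   : Cubic n
    S T  : LinearMap n n
    T∘S  : ∀ x → fun T (fun S x) ≡ + p • x
    S∘T  : ∀ x → fun S (fun T x) ≡ + p • x
    F-S  : ∀ x → F C′ (fun S x) ≡ F C x
    G-S  : ∀ x y → G C′ (fun S x) (fun S y) ≡ G C x y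
    l    : Fin n
    S-l  : ∀ x → + p ∣ lookup (fun S x) l

module _ {p m} (pr : Prime p) (C : Cubic (10 ℕ.+ m)) (d : ℤ) {{d≢0 : NonZero d}} (d≡1 : d ≡ + 1)
  (singular₀ : NoSmoothPoint C d (+ p))
  (singular₁ : NoSmoothPoint C (d * + p) (+ p))
  (singular₂ : NoSmoothPoint C (d * + p * + p) (+ p)) where

  private
    π : ℤ
    π = + p
    r : ℕ
    r = 10 ℕ.+ m
    instance
      π≢0 : NonZero π
      π≢0 = +p-nonZero pr
      dπ≢0 : NonZero (d * π)
      dπ≢0 = ℤₚ.i*j≢0 d π
      dπ²≢0 : NonZero (d * π * π)
      dπ²≢0 = ℤₚ.i*j≢0 (d * π) π
      dπ³≢0 : NonZero (d * π * π * π)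
      dπ³≢0 = ℤₚ.i*j≢0 (d * π * π) π

  L₀ : V r → Set
  L₀ _ = ⊤

  level₀ : Level C d L₀
  level₀ = record
    { L-⊕ = λ _ _ → tt ; L-• = λ _ _ → tt
    ; L⇒∣F = λ {x} _ → divides (F C x) (sym (trans (cong (F C x *_) d≡1) (ℤₚ.*-identityʳ (F C x))))
    ; L⇒∣G = λ {x} {y} _ _ → divides (G C x y) (sym (trans (cong (G C x y *_) d≡1) (ℤₚ.*-identityʳ (G C x y))))
    }

  private
    module N₁ = NextLevel level₀ singular₀
    module N₂ = NextLevel N₁.next singular₁
    module N₃ = NextLevel N₂.next singular₂

  L₃ : V r → Set
  L₃ = N₃.Next

  level₃ : Level C (d * π * π * π) L₃
  level₃ = N₃.next

  π³≡ : ∀ a → π * (π * π) * a ≡ a * (d * π * π * π)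
  π³≡ a = trans (alg π a) (cong (λ t → a * (t * π * π * π)) (sym d≡1))
    where
    alg : ∀ q a → q * (q * q) * a ≡ a * (+ 1 * q * q * q)
    alg = solve-∀

  -- F (p x) = p³ F x has exactly the divisibility reached after three steps.
  p•x∈L₃ : ∀ x → L₃ (π • x)
  p•x∈L₃ x = ((tt , N₂.d∣dπ (N₃.d∣dπ ∣F)) , N₃.d∣dπ ∣F) , ∣F
    where
    ∣F : d * π * π * π ∣ F C (π • x)
    ∣F = divides (F C x) (trans (F-• C π x) (π³≡ (F C x)))

  opaque
    -- The number of variables drops from 10 + m to 7 + m, 4 + m and 1 + m, so at least one
    -- dimension survives; injectivity modulo p passes through the composition.
    L₃-in-span : ∃ λ (g : LinearMap (1 ℕ.+ m) r) → Reflects π g × ∀ x → L₃ (fun g x)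
    L₃-in-span =
      let g₁ , g₁-reflects , Ng₁ = zeros-in-Next pr level₀ singular₀ idₗ (λ _ → tt)
          g₂ , g₂-reflects , Ng₂ = zeros-in-Next pr N₁.next singular₁ g₁ Ng₁
          g₃ , g₃-reflects , Ng₃ = zeros-in-Next pr N₂.next singular₂ (g₁ ∘ₗ g₂) Ng₂
      in g₁ ∘ₗ g₂ ∘ₗ g₃ ,
         (λ x h → g₃-reflects x (g₂-reflects (fun g₃ x) (g₁-reflects (fun g₂ (fun g₃ x)) h))) ,
         Ng₃

  opaque
    primitive∈L₃ : ∃ λ w → L₃ w × ∃ λ l → ¬ π ∣ lookup w l
    primitive∈L₃ = let g , g-reflects , L₃g = L₃-in-span in
      fun g (𝟙 zero) , L₃g (𝟙 zero) ,
      Finₚ.¬∀⟶∃¬ r _ (λ i → π ∣? lookup (fun g (𝟙 zero)) i)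
        (λ h → ℕₚ.<⇒≱ (ℕ.nonTrivial⇒n>1 p {{prime⇒nonTrivial pr}}) (ℕᵈ.∣⇒≤ (∣⇒∣ᵤ (g-reflects (𝟙 zero) h zero))))

  opaque
    -- Scaling by an inverse u of wₗ modulo p makes the coordinate 1 - t p, and the missing t p is
    -- supplied by a vector of pℤʳ, which lies in `L₃`. A coordinate equal to 1 lets w replace a
    -- basis vector.
    normalised∈L₃ : ∃ λ w → L₃ w × ∃ λ l → lookup w l ≡ + 1
    normalised∈L₃ with primitive∈L₃
    ... | w , L₃w , l , ∤wₗ with unit-inverse pr ∤wₗ
    ... | u , t , uw+tp≡1 =
      (u • w ⊕ π • t • 𝟙 l) , L-⊕ level₃ (L-• level₃ u L₃w) (p•x∈L₃ (t • 𝟙 l)) , l , (begin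
        lookup (u • w ⊕ π • t • 𝟙 l) l            ≡⟨ lookup-⊕ (u • w) (π • t • 𝟙 l) l ⟩
        lookup (u • w) l + lookup (π • t • 𝟙 l) l ≡⟨ cong₂ _+_ (lookup-• u w l)
          (trans (lookup-• π (t • 𝟙 l) l) (cong (π *_) (trans (lookup-• t (𝟙 l) l) (cong (t *_) (lookup-𝟙 l))))) ⟩
        u * lookup w l + π * (t * + 1)            ≡⟨ cong (λ s → u * lookup w l + s) (alg π t) ⟩
        u * lookup w l + t * π                    ≡⟨ uw+tp≡1 ⟩
        + 1 ∎)
      where
      open ≡-Reasoning
      alg : ∀ a t → a * (t * + 1) ≡ t * a
      alg = solve-∀

  -- The larger lattice is spanned by the old one and w / p, with w replacing the l-th basis vector.
  refine₁₀ : Refinement p C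
  refine₁₀ with normalised∈L₃
  ... | w , L₃w , l , wₗ≡1 = record
    { C′ = divided ; S = S ; T = T ; T∘S = T∘S ; S∘T = S∘T
    ; F-S = λ x → ℤₚ.*-cancelʳ-≡ _ _ (d * π * π * π) (trans (sym (F≡ (fun S x))) (trans (cong (F C) (T∘S x))
              (trans (F-• C π x) (π³≡ (F C x)))))
    ; G-S = λ x y → ℤₚ.*-cancelʳ-≡ _ _ (d * π * π * π) (trans (sym (G≡ (fun S x) (fun S y))) (trans (cong₂ (G C) (T∘S x) (T∘S y))
              (trans (G-•ˡ C π x (π • y)) (trans (cong (π * π *_) (G-•ʳ C π x y)) (trans (π²π π (G C x y)) (π³≡ (G C x y)))))))
    ; l = l ; S-l = λ x → divides (lookup x l) (Sₗ x)
    }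
    where
    open ≡-Reasoning
    v v⁻ : V r
    v  = w ⊕ - π • 𝟙 l
    v⁻ = - + 1 • v
    -- `T` takes 𝟙 l to w and every other 𝟙 i to p 𝟙 i, that is, to p times the new basis. `S` is p
    -- T⁻¹, integral because wₗ = 1.
    T S : LinearMap r r
    T = scale π +ₗ rankOne l v
    S = idₗ +ₗ rankOne l v⁻
    π²π : ∀ q g → q * q * (q * g) ≡ q * (q * q) * g
    π²π = solve-∀
    vₗ : lookup v l ≡ + 1 - π
    vₗ = trans (lookup-⊕ w (- π • 𝟙 l) l) (cong₂ _+_ wₗ≡1
           (trans (lookup-• (- π) (𝟙 l) l) (trans (cong (- π *_) (lookup-𝟙 l)) (ℤₚ.*-identityʳ (- π)))))
    Sₗ : ∀ x → lookup (fun S x) l ≡ lookup x l * π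
    Sₗ x = begin
      lookup (x ⊕ lookup x l • v⁻) l          ≡⟨ lookup-⊕ x (lookup x l • v⁻) l ⟩
      lookup x l + lookup (lookup x l • v⁻) l ≡⟨ cong (λ s → lookup x l + s) (trans (lookup-• (lookup x l) v⁻ l)
        (cong (lookup x l *_) (trans (lookup-• (- + 1) v l) (cong (- + 1 *_) vₗ)))) ⟩
      lookup x l + lookup x l * (- + 1 * (+ 1 - π)) ≡⟨ alg (lookup x l) π ⟩
      lookup x l * π ∎
      where
      alg : ∀ a q → a + a * (- + 1 * (+ 1 - q)) ≡ a * q
      alg = solve-∀
    Tₗ : ∀ x → lookup (fun T x) l ≡ lookup x l
    Tₗ x = begin
      lookup (π • x ⊕ lookup x l • v) l              ≡⟨ lookup-⊕ (π • x) (lookup x l • v) l ⟩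
      lookup (π • x) l + lookup (lookup x l • v) l   ≡⟨ cong₂ _+_ (lookup-• π x l)
        (trans (lookup-• (lookup x l) v l) (cong (lookup x l *_) vₗ)) ⟩
      π * lookup x l + lookup x l * (+ 1 - π)        ≡⟨ alg (lookup x l) π ⟩
      lookup x l ∎
      where
      alg : ∀ a q → q * a + a * (+ 1 - q) ≡ a
      alg = solve-∀
    cancelˡ : ∀ {n} q a (x v : V n) → (q • (x ⊕ a • - + 1 • v)) ⊕ (a * q) • v ≡ q • x
    cancelˡ q a []      []      = refl
    cancelˡ q a (b ∷ x) (c ∷ v) = cong₂ _∷_ (alg q a b c) (cancelˡ q a x v)
      where
      alg : ∀ q a b c → q * (b + a * (- + 1 * c)) + a * q * c ≡ q * b
      alg = solve-∀
    cancelʳ : ∀ {n} q a (x v : V n) → (q • x ⊕ a • v) ⊕ a • - + 1 • v ≡ q • x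
    cancelʳ q a []      []      = refl
    cancelʳ q a (b ∷ x) (c ∷ v) = cong₂ _∷_ (alg q a b c) (cancelʳ q a x v)
      where
      alg : ∀ q a b c → (q * b + a * c) + a * (- + 1 * c) ≡ q * b
      alg = solve-∀
    T∘S : ∀ x → fun T (fun S x) ≡ π • x
    T∘S x = trans (cong (λ a → (π • fun S x) ⊕ a • v) (Sₗ x)) (cancelˡ π (lookup x l) x v)
    S∘T : ∀ x → fun S (fun T x) ≡ π • x
    S∘T x = trans (cong (λ a → fun T x ⊕ a • v⁻) (Tₗ x)) (cancelʳ π (lookup x l) x v)
    L₃T : ∀ x → L₃ (fun T x)
    L₃T x = subst L₃ (regroup π (lookup x l) x w (𝟙 l))
      (L-⊕ level₃ (p•x∈L₃ (x ⊕ - lookup x l • 𝟙 l)) (L-• level₃ (lookup x l) L₃w))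
      where
      regroup : ∀ {n} q a (x w e : V n) → q • (x ⊕ - a • e) ⊕ a • w ≡ q • x ⊕ a • (w ⊕ - q • e)
      regroup q a []      []      []      = refl
      regroup q a (b ∷ x) (c ∷ w) (i ∷ e) = cong₂ _∷_ (alg q a b c i) (regroup q a x w e)
        where
        alg : ∀ q a b c i → q * (b + - a * i) + a * c ≡ q * b + a * (c + - q * i)
        alg = solve-∀
    -- Since d = 1, the quotient at x is C (T x) / p³, the value of C at the lattice vector T x / p.
    open Division (pullback C T) (d * π * π * π) (λ x → L⇒∣F level₃ (L₃T x)) (λ x y → L⇒∣G level₃ (L₃T x) (L₃T y))

refine : ∀ {p r} → Prime p → 9 < r → (C : Cubic r) →
  NoSmoothPoint C (+ 1) (+ p) → NoSmoothPoint C (+ 1 * + p) (+ p) → NoSmoothPoint C (+ 1 * + p * + p) (+ p) →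
  Refinement p C
refine pr 9<r C with ℕₚ.m≤n⇒∃[o]m+o≡n 9<r
... | m , refl = refine₁₀ pr C (+ 1) refl

-- Deciding the existence of smooth points

open SmoothPoint

∣-subtract : ∀ {d a b} → d ∣ a - b → d ∣ a → d ∣ b
∣-subtract {d} {a} {b} h u = ∣-resp-≡ (alg a b) (∣m∣n⇒∣m-n u h)
  where
  alg : ∀ a b → a - (a - b) ≡ b
  alg = solve-∀

∣-add : ∀ {d a b} → d ∣ a - b → d ∣ b → d ∣ a
∣-add {d} {a} {b} h u = ∣-resp-≡ (alg a b) (∣m∣n⇒∣m+n h u)
  where
  alg : ∀ a b → (a - b) + b ≡ a
  alg = solve-∀

module _ {n} (C : Cubic n) {D M : ℤ} (D∣M : D ∣ M) where

  F-periodic : ∀ x q → D ∣ F C (x ⊕ M • q) - F C x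
  F-periodic x q = ∣-resp-≡ (sym (trans (cong (_- F C x) (F-⊕ C x (M • q))) (alg (F C x) _ _ _)))
    (∣m∣n⇒∣m+n (∣m∣n⇒∣m+n
      (∣-resp-≡ (sym (G-•ʳ C M x q)) (∣m⇒∣m*n (G C x q) D∣M))
      (∣-resp-≡ (sym (G-•ˡ C M q x)) (∣m⇒∣m*n (G C q x) (∣m⇒∣m*n M D∣M))))
      (∣-resp-≡ (sym (F-• C M q)) (∣m⇒∣m*n (F C q) (∣m⇒∣m*n (M * M) D∣M))))
    where
    alg : ∀ a b c e → a + b + c + e - a ≡ b + c + e
    alg = solve-∀

  G-periodicˡ : ∀ x q y → D ∣ G C (x ⊕ M • q) y - G C x y
  G-periodicˡ x q y = ∣-resp-≡ (sym (trans (cong (_- G C x y) (G-⊕ˡ C x (M • q) y)) (alg (G C x y) _ _)))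
    (∣m∣n⇒∣m+n
      (∣-resp-≡ (sym (G-•ˡ C M q y)) (∣m⇒∣m*n (G C q y) (∣m⇒∣m*n M D∣M)))
      (∣-resp-≡ (sym (trans (Φ-cyclic C x (M • q) y) (trans (Φ-cyclic C (M • q) y x) (Linear.hom (Φ-linear C y x) M q))))
        (∣m⇒∣m*n (Φ C y x q) D∣M)))
    where
    alg : ∀ a b c → a + b + c - a ≡ b + c
    alg = solve-∀

  G-periodicʳ : ∀ x y q → D ∣ G C x (y ⊕ M • q) - G C x y
  G-periodicʳ x y q = ∣-resp-≡
    (sym (trans (cong (_- G C x y) (trans (G-⊕ʳ C x y (M • q)) (cong (λ t → G C x y + t) (G-•ʳ C M x q)))) (alg (G C x y) _)))
    (∣m⇒∣m*n (G C x q) D∣M)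
    where
    alg : ∀ a b → a + b - a ≡ b
    alg = solve-∀

residues : ∀ {N n} → Vec (Fin N) n → V n
residues = map (λ t → + toℕ t)

search : ∀ {N} n (P : V n → Set) → (∀ x → Dec (P x)) → Dec (∃ λ (x : Vec (Fin N) n) → P (residues x))
search zero    P P? = map′ (λ h → [] , h) (λ { ([] , h) → h }) (P? [])
search (suc n) P P? =
  map′ (λ { (t , x , h) → (t ∷ x) , h }) (λ { ((t ∷ x) , h) → t , x , h })
    (Finₚ.any? (λ t → search n (λ x → P (+ toℕ t ∷ x)) (λ x → P? (+ toℕ t ∷ x))))

reduce : ∀ {n} N → {{_ : ℕ.NonZero N}} → (x : V n) → ∃ λ (x′ : Vec (Fin N) n) → ∃ λ q → x ≡ residues x′ ⊕ + N • q
reduce N []      = [] , [] , refl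
reduce N (a ∷ x) with reduce N x
... | x′ , q , e = (Fin.fromℕ< (ℤᵈ.n%ℕd<d a N) ∷ x′) , (a ℤᵈ./ℕ N ∷ q) ,
  cong₂ _∷_ (trans (ℤᵈ.a≡a%ℕn+[a/ℕn]*n a N)
    (cong₂ _+_ (cong +_ (sym (Finₚ.toℕ-fromℕ< (ℤᵈ.n%ℕd<d a N)))) (ℤₚ.*-comm (a ℤᵈ./ℕ N) (+ N)))) e

smoothPoint? : ∀ {n} (C : Cubic n) d π x y → Dec (SmoothPoint C d π x y)
smoothPoint? C d π x y =
  map′ (λ { (a , b , c , e , f) → record { ∣Gxy = a ; ∣Gyx = b ; ∣Fy = c ; zero-x = e ; unit-G = f } })
       (λ s → ∣Gxy s , ∣Gyx s , ∣Fy s , zero-x s , unit-G s)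
    ((d ∣? G C x y) ×-dec (d ∣? G C y x) ×-dec (d ∣? F C y) ×-dec (d * π ∣? F C x) ×-dec ¬? (d * π ∣? G C x y))

module _ {n} (C : Cubic n) (d π : ℤ) where

  smoothPoint-periodicˡ : ∀ {M} → d * π ∣ M → ∀ x q y → SmoothPoint C d π (x ⊕ M • q) y → SmoothPoint C d π x y
  smoothPoint-periodicˡ D∣M x q y s = record
    { ∣Gxy   = ∣-subtract (d∣ (G-periodicˡ C D∣M x q y)) (∣Gxy s)
    ; ∣Gyx   = ∣-subtract (d∣ (G-periodicʳ C D∣M y x q)) (∣Gyx s)
    ; ∣Fy    = ∣Fy s
    ; zero-x = ∣-subtract (F-periodic C D∣M x q) (zero-x s)
    ; unit-G = λ h → unit-G s (∣-add (G-periodicˡ C D∣M x q y) h)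
    }
    where
    d∣ : ∀ {a} → d * π ∣ a → d ∣ a
    d∣ = ∣-trans (∣-self* π)

  smoothPoint-periodicʳ : ∀ {M} → d * π ∣ M → ∀ x y q → SmoothPoint C d π x (y ⊕ M • q) → SmoothPoint C d π x y
  smoothPoint-periodicʳ D∣M x y q s = record
    { ∣Gxy   = ∣-subtract (d∣ (G-periodicʳ C D∣M x y q)) (∣Gxy s)
    ; ∣Gyx   = ∣-subtract (d∣ (G-periodicˡ C D∣M y q x)) (∣Gyx s)
    ; ∣Fy    = ∣-subtract (d∣ (F-periodic C D∣M y q)) (∣Fy s)
    ; zero-x = zero-x s
    ; unit-G = λ h → unit-G s (∣-add (G-periodicʳ C D∣M x y q) h)
    }
    where
    d∣ : ∀ {a} → d * π ∣ a → d ∣ a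
    d∣ = ∣-trans (∣-self* π)

  opaque
    -- The conditions are divisibilities by d and d π of integral polynomials in x and y, so they
    -- only see residues modulo d π.
    findSmoothPoint : {{_ : NonZero (d * π)}} →
      (∃ λ x → ∃ λ y → SmoothPoint C d π x y) ⊎ NoSmoothPoint C d π
    findSmoothPoint = decide (search {N} n (λ x → ∃ λ (y : Vec (Fin N) n) → SmoothPoint C d π x (residues y))
        (λ x → search n (SmoothPoint C d π x) (smoothPoint? C d π x)))
      where
      N : ℕ
      N = abs (d * π)
      decide : Dec (∃ λ (x : Vec (Fin N) n) → ∃ λ (y : Vec (Fin N) n) → SmoothPoint C d π (residues x) (residues y)) →
        (∃ λ x → ∃ λ y → SmoothPoint C d π x y) ⊎ NoSmoothPoint C d π
      decide (yes (x , y , s)) = inj₁ (residues x , residues y , s)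
      decide (no ¬s) = inj₂ λ x y s →
        let x′ , q , x≡ = reduce N x
            y′ , q′ , y≡ = reduce N y
        in ¬s (x′ , y′ ,
             smoothPoint-periodicˡ m∣∣m∣ (residues x′) q (residues y′)
               (smoothPoint-periodicʳ m∣∣m∣ (residues x′ ⊕ + N • q) (residues y′) q′
                 (subst₂ (SmoothPoint C d π) x≡ y≡ s)))

-- Elimination

linear-combination : ∀ {n} a b {f g : V n → ℤ} → Linear f → Linear g → Linear (λ x → a * f x - b * g x)
linear-combination a b {f} {g} lf lg = record
  { add = λ x y → trans (cong₂ (λ s t → a * s - b * t) (Linear.add lf x y) (Linear.add lg x y))
                        (alg a b (f x) (f y) (g x) (g y))
  ; hom = λ c x → trans (cong₂ (λ s t → a * s - b * t) (Linear.hom lf c x) (Linear.hom lg c x))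
                        (alg′ a b c (f x) (g x))
  }
  where
  alg : ∀ a b s t u v → a * (s + t) - b * (u + v) ≡ (a * s - b * u) + (a * t - b * v)
  alg = solve-∀
  alg′ : ∀ a b c s u → a * (c * s) - b * (c * u) ≡ c * (a * s - b * u)
  alg′ = solve-∀

∣-linear : ∀ {n} {f : V n → ℤ} {m} Δ → Linear f → ∀ x → (∀ l → m ∣ Δ * lookup x l) → m ∣ Δ * f x
∣-linear {f = f} {m} Δ lf x h with divisible⇒• m (Δ • x) (λ l → ∣-resp-≡ (sym (lookup-• Δ x l)) (h l))
... | u , e = ∣-resp-≡ (trans (sym (Linear.hom lf m u)) (trans (cong f (sym e)) (Linear.hom lf Δ x))) (∣-self* (f u))

module _ {I : Set} (nonzero? : (f : I → ℤ) → (∃ λ i → f i ≢ + 0) ⊎ (∀ i → f i ≡ + 0)) where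

  -- Fraction-free Gaussian elimination. With the pivot c = φ j (𝟙 zero), the combinations ψ i no
  -- longer involve the first variable. A kernel vector lifts by solving φ j = 0 for the first
  -- coordinate; a bound lifts at the cost of a factor c. As Δ is the same for all m, it is a common
  -- denominator for all rational x with integral φ i x.
  kernel-or-bound : ∀ n (φ : I → V n → ℤ) → (∀ i → Linear (φ i)) →
    (∃ λ v → v ≢ 𝟘 × ∀ i → φ i v ≡ + 0) ⊎
    (∃ λ Δ → Δ ≢ + 0 × ∀ m x → (∀ i → m ∣ φ i x) → ∀ l → m ∣ Δ * lookup x l)
  kernel-or-bound zero    φ lφ = inj₂ (+ 1 , (λ ()) , λ m x h ())
  kernel-or-bound (suc n) φ lφ with nonzero? (λ i → φ i (𝟙 zero))
  ... | inj₂ all0 = inj₁ (𝟙 zero , (λ ()) , all0)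
  ... | inj₁ (j , c≢0) = [ lift-kernel , lift-bound ]′
          (kernel-or-bound n ψ (λ i → linear-combination c (φ i (𝟙 zero)) (linear-tail (lφ i)) (linear-tail (lφ j))))
    where
    c : ℤ
    c = φ j (𝟙 zero)
    instance
      c-nonZero : NonZero c
      c-nonZero = ℤ.≢-nonZero c≢0
    φ′ : I → V n → ℤ
    φ′ i x = φ i (+ 0 ∷ x)
    ψ : I → V n → ℤ
    ψ i x = c * φ′ i x - φ i (𝟙 zero) * φ′ j x
    lift-kernel : (∃ λ v → v ≢ 𝟘 × ∀ i → ψ i v ≡ + 0) →
      (∃ λ v → v ≢ 𝟘 × ∀ i → φ i v ≡ + 0) ⊎
      (∃ λ Δ → Δ ≢ + 0 × ∀ m x → (∀ i → m ∣ φ i x) → ∀ l → m ∣ Δ * lookup x l)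
    lift-kernel (v , v≢0 , ψv≡0) = inj₁
      ( (- φ′ j v ∷ c • v)
      , (λ e → v≢0 (•-cancel c v 𝟘 (trans (Vecₚ.∷-injectiveʳ e) (sym (•-𝟘 c)))))
      , λ i → trans (linear-∷ (lφ i) (- φ′ j v) (c • v))
                (trans (cong (λ t → - φ′ j v * φ i (𝟙 zero) + t) (Linear.hom (linear-tail (lφ i)) c v))
                  (trans (alg (φ′ j v) (φ i (𝟙 zero)) (c * φ′ i v)) (ψv≡0 i))))
      where
      alg : ∀ a b d → - a * b + d ≡ d - b * a
      alg = solve-∀
    lift-bound : (∃ λ Δ → Δ ≢ + 0 × ∀ m x → (∀ i → m ∣ ψ i x) → ∀ l → m ∣ Δ * lookup x l) →
      (∃ λ v → v ≢ 𝟘 × ∀ i → φ i v ≡ + 0) ⊎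
      (∃ λ Δ → Δ ≢ + 0 × ∀ m x → (∀ i → m ∣ φ i x) → ∀ l → m ∣ Δ * lookup x l)
    lift-bound (Δ , Δ≢0 , bound) = inj₂ (Δ * c , Δc≢0 , bound′)
      where
      Δc≢0 : Δ * c ≢ + 0
      Δc≢0 e = Δ≢0 (ℤₚ.*-cancelʳ-≡ Δ (+ 0) c (trans e (sym (ℤₚ.*-zeroˡ c))))
      bound′ : ∀ m x → (∀ i → m ∣ φ i x) → ∀ l → m ∣ Δ * c * lookup x l
      bound′ m (a ∷ x) h l = at l
        where
        ∣ψ : ∀ i → m ∣ ψ i x
        ∣ψ i = ∣-resp-≡ (trans (cong₂ (λ s t → c * s - φ i (𝟙 zero) * t) (linear-∷ (lφ i) a x) (linear-∷ (lφ j) a x))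
                          (alg c (φ i (𝟙 zero)) a (φ′ i x) (φ′ j x)))
                 (∣m∣n⇒∣m-n (∣n⇒∣m*n c (h i)) (∣n⇒∣m*n (φ i (𝟙 zero)) (h j)))
          where
          alg : ∀ c d a s t → c * (a * d + s) - d * (a * c + t) ≡ c * s - d * t
          alg = solve-∀
        ∣tail : ∀ l → m ∣ Δ * lookup x l
        ∣tail = bound m x ∣ψ
        ∣φ′ : m ∣ Δ * φ′ j x
        ∣φ′ = ∣-linear Δ (linear-tail (lφ j)) x ∣tail
        at : ∀ l → m ∣ Δ * c * lookup (a ∷ x) l
        -- The pivot row recovers the first coordinate: a c = φ j (a ∷ x) - φ′ j x.
        at zero    = ∣-resp-≡ (trans (cong (λ t → Δ * t - Δ * φ′ j x) (linear-∷ (lφ j) a x)) (alg Δ c a (φ′ j x)))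
                       (∣m∣n⇒∣m-n (∣n⇒∣m*n Δ (h j)) ∣φ′)
          where
          alg : ∀ D c a s → D * (a * c + s) - D * s ≡ D * c * a
          alg = solve-∀
        at (suc l) = ∣-resp-≡ (alg Δ c (lookup x l)) (∣n⇒∣m*n c (∣tail l))
          where
          alg : ∀ D c y → c * (D * y) ≡ D * c * y
          alg = solve-∀

-- Finiteness of the descent

open Refinement

-- A lattice containing ℤⁿ, with C the form in its coordinates: P is the inclusion of ℤⁿ, and Q
-- maps p ^ level times the lattice back into ℤⁿ.
record Overlattice {n} (p : ℕ) (C₀ C : Cubic n) : Set where
  field
    level : ℕ
    P Q   : LinearMap n n
    P∘Q   : ∀ x → fun P (fun Q x) ≡ pow p level • x
    F-P   : ∀ x → F C (fun P x) ≡ F C₀ x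
    G-P   : ∀ x y → G C (fun P x) (fun P y) ≡ G C₀ x y

open Overlattice

trivialOverlattice : ∀ {n} p (C : Cubic n) → Overlattice p C C
trivialOverlattice p C = record
  { level = 0 ; P = idₗ ; Q = idₗ ; P∘Q = λ x → sym (1-• x) ; F-P = λ _ → refl ; G-P = λ _ _ → refl }

enlarge : ∀ {n p} {C₀ C : Cubic n} → Overlattice p C₀ C → (R : Refinement p C) → Overlattice p C₀ (C′ R)
enlarge {p = p} M R = record
  { level = suc (level M)
  ; P = S R ∘ₗ P M
  ; Q = Q M ∘ₗ T R
  ; P∘Q = λ x → trans (cong (fun (S R)) (P∘Q M (fun (T R) x)))
            (trans (LinearMap.hom (S R) (pow p (level M)) (fun (T R) x))
            (trans (cong (pow p (level M) •_) (S∘T R x)) (sym (•-assoc (pow p (level M)) (+ p) x))))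
  ; F-P = λ x → trans (F-S R (fun (P M) x)) (F-P M x)
  ; G-P = λ x y → trans (G-S R (fun (P M) x) (fun (P M) y)) (G-P M x y)
  }

module Descent {r p} (pr : Prime p) (9<r : 9 < r) (C₀ : Cubic r) (Δ : ℤ) (Δ≢0 : Δ ≢ + 0)
  (bound : ∀ d x → (∀ i j → d ∣ Φ C₀ (𝟙 i) (𝟙 j) x) → ∀ l → d ∣ Δ * lookup x l)
  (A : Set)
  (done : ∀ C → Overlattice p C₀ C → ∀ k x y → SmoothPoint C (pow p k) (+ p) x y → A)
  where

  private
    N : ℕ
    N = abs Δ
    instance
      Δ-nonZero : NonZero Δ
      Δ-nonZero = ℤ.≢-nonZero Δ≢0

  Φ-P : ∀ {C} (M : Overlattice p C₀ C) x y z → Φ C (fun (P M) x) (fun (P M) y) (fun (P M) z) ≡ Φ C₀ x y z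
  Φ-P {C} M x y z = cong₂ _-_ (cong₂ _-_
    (trans (cong (λ v → G C v (fun (P M) z)) (sym (LinearMap.add (P M) x y))) (G-P M (x ⊕ y) z)) (G-P M x z)) (G-P M y z)

  -- A vector y of the overlattice pairs integrally under Φ with the basis of ℤⁿ. For Q y, which is
  -- π = p^level times y, this says that π divides Φ (𝟙 i) (𝟙 j) (Q y), so π divides Δ Q y by
  -- `bound`.
  Δ•-in-image : ∀ {C} (M : Overlattice p C₀ C) y → ∃ λ u → fun (P M) u ≡ Δ • y
  Δ•-in-image {C} M y = u , •-cancel π {{pow-nonZero pr (level M)}} (fun (P M) u) (Δ • y) (begin
    π • fun (P M) u        ≡⟨ sym (LinearMap.hom (P M) π u) ⟩
    fun (P M) (π • u)      ≡⟨ cong (fun (P M)) (sym ΔQy≡) ⟩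
    fun (P M) (Δ • fun (Q M) y) ≡⟨ LinearMap.hom (P M) Δ (fun (Q M) y) ⟩
    Δ • fun (P M) (fun (Q M) y) ≡⟨ cong (Δ •_) (P∘Q M y) ⟩
    Δ • π • y              ≡⟨ •-comm Δ π y ⟩
    π • Δ • y              ∎)
    where
    open ≡-Reasoning
    π : ℤ
    π = pow p (level M)
    ∣Φ : ∀ i j → π ∣ Φ C₀ (𝟙 i) (𝟙 j) (fun (Q M) y)
    ∣Φ i j = ∣-resp-≡ (trans (sym (Linear.hom (Φ-linear C (fun (P M) (𝟙 i)) (fun (P M) (𝟙 j))) π y))
        (trans (cong (Φ C (fun (P M) (𝟙 i)) (fun (P M) (𝟙 j))) (sym (P∘Q M y)))
               (Φ-P M (𝟙 i) (𝟙 j) (fun (Q M) y))))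
      (∣-self* (Φ C (fun (P M) (𝟙 i)) (fun (P M) (𝟙 j)) y))
    quotients : ∃ λ u → Δ • fun (Q M) y ≡ π • u
    quotients = divisible⇒• π (Δ • fun (Q M) y)
      (λ l → ∣-resp-≡ (sym (lookup-• Δ (fun (Q M) y) l)) (bound π (fun (Q M) y) ∣Φ l))
    u : V r
    u = proj₁ quotients
    ΔQy≡ : Δ • fun (Q M) y ≡ π • u
    ΔQy≡ = proj₂ quotients

  -- Distinct classes in ℤⁿ / Δℤⁿ contained in Δ times the overlattice.
  record Classes {C} (M : Overlattice p C₀ C) (k : ℕ) : Set where
    field
      z        : Fin k → V r
      inΔ      : ∀ i → ∃ λ y → fun (P M) (z i) ≡ Δ • y
      distinct : ∀ i j v → z i ≡ z j ⊕ Δ • v → i ≡ j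

  open Classes

  classes≤ : ∀ {C k} {M : Overlattice p C₀ C} → Classes M k → k ℕ.≤ N ℕ.^ r
  classes≤ {k = k} cl = Finₚ.injective⇒≤ {f = code} code-injective
    where
    instance
      N≢0 : ℕ.NonZero N
      N≢0 = Δ-nonZero
    res : Fin k → Vec (Fin N) r
    res i = proj₁ (reduce N (z cl i))
    code : Fin k → Fin (N ℕ.^ r)
    code i = Fin.funToFin (lookup (res i))
    code-injective : ∀ {i j} → code i ≡ code j → i ≡ j
    code-injective {i} {j} e = distinct cl i j _ (begin
      z cl i                     ≡⟨ zi≡ ⟩
      residues (res i) ⊕ + N • q ≡⟨ cong (λ w → residues w ⊕ + N • q) res≡ ⟩
      residues (res j) ⊕ + N • q ≡⟨ cong (λ t → residues (res j) ⊕ t • q) N≡ ⟩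
      residues (res j) ⊕ (ε * Δ) • q ≡⟨ regroup ε Δ (residues (res j)) q q′ ⟩
      (residues (res j) ⊕ (ε * Δ) • q′) ⊕ Δ • ε • (q ⊕ - + 1 • q′)
        ≡⟨ cong (λ t → (residues (res j) ⊕ t • q′) ⊕ Δ • ε • (q ⊕ - + 1 • q′)) (sym N≡) ⟩
      (residues (res j) ⊕ + N • q′) ⊕ Δ • ε • (q ⊕ - + 1 • q′)
        ≡⟨ cong (_⊕ Δ • ε • (q ⊕ - + 1 • q′)) (sym zj≡) ⟩
      z cl j ⊕ Δ • ε • (q ⊕ - + 1 • q′) ∎)
      where
      open ≡-Reasoning
      q q′ : V r
      q  = proj₁ (proj₂ (reduce N (z cl i)))
      q′ = proj₁ (proj₂ (reduce N (z cl j)))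
      zi≡ : z cl i ≡ residues (res i) ⊕ + N • q
      zi≡ = proj₂ (proj₂ (reduce N (z cl i)))
      zj≡ : z cl j ≡ residues (res j) ⊕ + N • q′
      zj≡ = proj₂ (proj₂ (reduce N (z cl j)))
      -- `reduce` works modulo the natural number N = |Δ|; ε is the sign that returns to Δ itself.
      ε : ℤ
      ε = quotient (m∣∣m∣ {Δ})
      N≡ : + N ≡ ε * Δ
      N≡ = _∣_.equality (m∣∣m∣ {Δ})
      res≡ : res i ≡ res j
      res≡ = trans (sym (Vecₚ.tabulate∘lookup (res i))) (trans (Vecₚ.tabulate-cong (λ l →
        trans (sym (Finₚ.finToFun-funToFin (lookup (res i)) l))
        (trans (cong (λ c → Fin.finToFun c l) e) (Finₚ.finToFun-funToFin (lookup (res j)) l))))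
        (Vecₚ.tabulate∘lookup (res j)))
      regroup : ∀ {n} ε D (a q q′ : V n) →
        a ⊕ (ε * D) • q ≡ (a ⊕ (ε * D) • q′) ⊕ D • ε • (q ⊕ - + 1 • q′)
      regroup ε D []      []      []       = refl
      regroup ε D (a ∷ x) (b ∷ q) (c ∷ q′) = cong₂ _∷_ (alg ε D a b c) (regroup ε D x q q′)
        where
        alg : ∀ e D a b c → a + e * D * b ≡ (a + e * D * c) + D * (e * (b + - + 1 * c))
        alg = solve-∀

  -- By `S-l` the basis vector 𝟙 l of the larger lattice is not in the smaller one. Its Δ-fold comes
  -- from some u in ℤʳ; if u were congruent to an old class modulo Δ, division by Δ would put 𝟙 l
  -- into the image of `S`.
  newClass : ∀ {C k} (M : Overlattice p C₀ C) (R : Refinement p C) → Classes M k → Classes (enlarge M R) (suc k)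
  newClass {C} {k} M R cl = record { z = z′ ; inΔ = inΔ′ ; distinct = distinct′ }
    where
    M′ : Overlattice p C₀ (C′ R)
    M′ = enlarge M R
    e u : V r
    e = 𝟙 (l R)
    u = proj₁ (Δ•-in-image M′ e)
    P′u≡ : fun (P M′) u ≡ Δ • e
    P′u≡ = proj₂ (Δ•-in-image M′ e)
    z′ : Fin (suc k) → V r
    z′ zero    = u
    z′ (suc i) = z cl i
    inΔ′ : ∀ i → ∃ λ y → fun (P M′) (z′ i) ≡ Δ • y
    inΔ′ zero    = e , P′u≡
    inΔ′ (suc i) = fun (S R) (proj₁ (inΔ cl i)) ,
      trans (cong (fun (S R)) (proj₂ (inΔ cl i))) (LinearMap.hom (S R) Δ (proj₁ (inΔ cl i)))
    e∉S : ∀ x → e ≢ fun (S R) x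
    e∉S x e≡ = ℕₚ.<⇒≱ (ℕ.nonTrivial⇒n>1 p {{prime⇒nonTrivial pr}})
      (ℕᵈ.∣⇒≤ (∣⇒∣ᵤ (∣-resp-≡ (trans (cong (λ v → lookup v (l R)) (sym e≡)) (lookup-𝟙 (l R))) (S-l R x))))
    new : ∀ j v → u ≢ z cl j ⊕ Δ • v
    new j v u≡ = e∉S (y ⊕ fun (P M) v) (•-cancel Δ e (fun (S R) (y ⊕ fun (P M) v)) (begin
      Δ • e                                      ≡⟨ sym P′u≡ ⟩
      fun (P M′) u                               ≡⟨ cong (fun (P M′)) u≡ ⟩
      fun (P M′) (z cl j ⊕ Δ • v)                ≡⟨ cong (fun (S R)) (trans (LinearMap.add (P M) (z cl j) (Δ • v))
           (trans (cong₂ _⊕_ (proj₂ (inΔ cl j)) (LinearMap.hom (P M) Δ v)) (sym (•-distribˡ Δ y (fun (P M) v))))) ⟩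
      fun (S R) (Δ • (y ⊕ fun (P M) v))          ≡⟨ LinearMap.hom (S R) Δ (y ⊕ fun (P M) v) ⟩
      Δ • fun (S R) (y ⊕ fun (P M) v)            ∎))
      where
      open ≡-Reasoning
      y : V r
      y = proj₁ (inΔ cl j)
    distinct′ : ∀ i j v → z′ i ≡ z′ j ⊕ Δ • v → i ≡ j
    distinct′ zero    zero    v h = refl
    distinct′ zero    (suc j) v h = ⊥-elim (new j v h)
    distinct′ (suc i) zero    v h = ⊥-elim (new i (- + 1 • v)
      (trans (cancel Δ u v) (cong (_⊕ Δ • - + 1 • v) (sym h))))
      where
      cancel : ∀ {n} D (u v : V n) → u ≡ (u ⊕ D • v) ⊕ D • - + 1 • v
      cancel D []      []      = refl
      cancel D (a ∷ u) (b ∷ v) = cong₂ _∷_ (alg D a b) (cancel D u v)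
        where
        alg : ∀ D a b → a ≡ (a + D * b) + D * (- + 1 * b)
        alg = solve-∀
    distinct′ (suc i) (suc j) v h = cong suc (distinct cl i j v h)

  smooth-or-refine : ∀ C → Overlattice p C₀ C → A ⊎ Refinement p C
  smooth-or-refine C M =
    at 0 refl (λ s₀ → at 1 refl (λ s₁ → at 2 refl (λ s₂ → inj₂ (refine pr 9<r C s₀ s₁ s₂))))
    where
    at : ∀ k {d} → pow p k ≡ d → (NoSmoothPoint C d (+ p) → A ⊎ Refinement p C) → A ⊎ Refinement p C
    at k refl next = [ (λ { (x , y , s) → inj₁ (done C M k x y s) }) , next ]′
      (findSmoothPoint C (pow p k) (+ p) {{pow-nonZero pr (suc k)}})

  -- Every enlargement adds a class and there are at most N ^ r of them, so the fuel cannot run out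
  -- before a smooth point is met.
  descend : ∀ fuel k → N ℕ.^ r < fuel ℕ.+ k → ∀ C (M : Overlattice p C₀ C) → Classes M k → A
  descend zero       k h C M cl = ⊥-elim (ℕₚ.<⇒≱ h (classes≤ cl))
  descend (suc fuel) k h C M cl = [ (λ a → a) , (λ R →
    descend fuel (suc k) (subst (N ℕ.^ r <_) (sym (ℕₚ.+-suc fuel k)) h) (C′ R) (enlarge M R) (newClass M R cl)) ]′
    (smooth-or-refine C M)

  result : A
  result = descend (suc (N ℕ.^ r)) 0 (s≤s (ℕₚ.m≤m+n (N ℕ.^ r) 0)) C₀ (trivialOverlattice p C₀)
    record { z = λ () ; inΔ = λ () ; distinct = λ () }

-- From smooth points to density

pow-+ : ∀ p a b → pow p (a ℕ.+ b) ≡ pow p a * pow p b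
pow-+ p zero    b = sym (ℤₚ.*-identityˡ (pow p b))
pow-+ p (suc a) b = trans (cong (_* + p) (pow-+ p a b)) (alg (pow p a) (pow p b) (+ p))
  where
  alg : ∀ x y q → x * y * q ≡ x * q * y
  alg = solve-∀

pow≡+^ : ∀ p k → pow p k ≡ + (p ^ k)
pow≡+^ p zero    = refl
pow≡+^ p (suc k) = trans (cong (_* + p) (pow≡+^ p k))
  (trans (sym (ℤₚ.pos-* (p ^ k) p)) (cong +_ (ℕₚ.*-comm (p ^ k) p)))

-- The p-adic closure of the values of f contains p^κ ℤ_p.
AttainsNear : ∀ {n} → ℕ → (V n → ℤ) → Set
AttainsNear p f = ∃ λ κ → ∀ s k → ∃ λ x → ∃ λ e → f x ≡ pow p κ * (s + pow p k * e)

poly : (c₀ c₁ c₂ c₃ t : ℤ) → ℤ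
poly c₀ c₁ c₂ c₃ t = c₀ + c₁ * t + c₂ * (t * t) + c₃ * (t * (t * t))

-- Replacing t by t + pᵏ h changes the value by pᵏ⁺¹ h (c₁ + p K). With u inverse to c₁ modulo p,
-- the choice h = - e u removes the error e modulo p. The argument p t and the constant term c₀ p
-- keep all values divisible by p.
newton : ∀ {p c₁} → Prime p → ¬ + p ∣ c₁ → ∀ c₀ c₂ c₃ s k → ∃ λ t → ∃ λ e →
  poly (c₀ * + p) c₁ c₂ c₃ (+ p * t) ≡ + p * (s + pow p k * e)
newton {p} {c₁} pr ∤c₁ c₀ c₂ c₃ s zero = + 0 , c₀ - s , alg c₀ c₁ c₂ c₃ s (+ p)
  where
  alg : ∀ c₀ c₁ c₂ c₃ s q →
    c₀ * q + c₁ * (q * + 0) + c₂ * (q * + 0 * (q * + 0)) + c₃ * (q * + 0 * (q * + 0 * (q * + 0))) ≡ q * (s + + 1 * (c₀ - s))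
  alg = solve-∀
newton {p} {c₁} pr ∤c₁ c₀ c₂ c₃ s (suc k) =
  let t , e , eq = newton pr ∤c₁ c₀ c₂ c₃ s k
      u , w , uc+wp≡1 = unit-inverse pr ∤c₁
      q = + p
      P = pow p k
      h = - (e * u)
      K = c₂ * (+ 2 * t + P * h) + c₃ * q * (+ 3 * t * t + + 3 * t * P * h + P * P * h * h)
  in t + P * h , e * w + h * K , (begin
    poly (c₀ * q) c₁ c₂ c₃ (q * (t + P * h))                    ≡⟨ taylor (c₀ * q) c₁ c₂ c₃ q t P h ⟩
    poly (c₀ * q) c₁ c₂ c₃ (q * t) + q * P * h * (c₁ + q * K)   ≡⟨ cong (_+ q * P * h * (c₁ + q * K)) eq ⟩
    q * (s + P * e) + q * P * h * (c₁ + q * K)                  ≡⟨ alg₁ q s P e u c₁ K ⟩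
    q * (s + P * (e * (+ 1 - u * c₁) + h * q * K))              ≡⟨ cong (λ v → q * (s + P * (e * v + h * q * K)))
        (trans (cong (_- u * c₁) (sym uc+wp≡1)) (alg₂ (u * c₁) (w * q))) ⟩
    q * (s + P * (e * (w * q) + h * q * K))                     ≡⟨ alg₃ q s P e w h K ⟩
    q * (s + P * q * (e * w + h * K))                           ∎)
  where
  open ≡-Reasoning
  taylor : ∀ c₀ c₁ c₂ c₃ q t P h →
    c₀ + c₁ * (q * (t + P * h)) + c₂ * (q * (t + P * h) * (q * (t + P * h))) + c₃ * (q * (t + P * h) * (q * (t + P * h) * (q * (t + P * h))))
    ≡ (c₀ + c₁ * (q * t) + c₂ * (q * t * (q * t)) + c₃ * (q * t * (q * t * (q * t))))
      + q * P * h * (c₁ + q * (c₂ * (+ 2 * t + P * h) + c₃ * q * (+ 3 * t * t + + 3 * t * P * h + P * P * h * h)))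
  taylor = solve-∀
  alg₁ : ∀ q s P e u c K → q * (s + P * e) + q * P * - (e * u) * (c + q * K) ≡
    q * (s + P * (e * (+ 1 - u * c) + - (e * u) * q * K))
  alg₁ = solve-∀
  alg₂ : ∀ a b → (a + b) - a ≡ b
  alg₂ = solve-∀
  alg₃ : ∀ q s P e w h K → q * (s + P * (e * (w * q) + h * q * K)) ≡ q * (s + P * q * (e * w + h * K))
  alg₃ = solve-∀

smooth⇒AttainsNear : ∀ {n p k x y} → Prime p → (C : Cubic n) → SmoothPoint C (pow p k) (+ p) x y → AttainsNear p (F C)
smooth⇒AttainsNear {n} {p} {k} {x} {y} pr C sp = suc k , λ s j → attain s j (newton pr ∤c₁ c₀ c₂ c₃ s j)
  where
  d c₀ c₁ c₂ c₃ : ℤ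
  d  = pow p k
  c₀ = quotient (zero-x sp)
  c₁ = quotient (∣Gxy sp)
  c₂ = quotient (∣Gyx sp)
  c₃ = quotient (∣Fy sp)
  ∤c₁ : ¬ + p ∣ c₁
  ∤c₁ h = unit-G sp (∣-resp-≡ (trans (ℤₚ.*-comm d c₁) (sym (_∣_.equality (∣Gxy sp)))) (*-monoʳ-∣ d h))
  F≡poly : ∀ t → F C (x ⊕ t • y) ≡ d * poly (c₀ * + p) c₁ c₂ c₃ t
  F≡poly t = begin
    F C (x ⊕ t • y)                                          ≡⟨ F-⊕ C x (t • y) ⟩
    F C x + G C x (t • y) + G C (t • y) x + F C (t • y)      ≡⟨ cong₂ _+_ (cong₂ _+_
      (cong₂ _+_ (_∣_.equality (zero-x sp)) (trans (G-•ʳ C t x y) (cong (t *_) (_∣_.equality (∣Gxy sp)))))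
      (trans (G-•ˡ C t y x) (cong (t * t *_) (_∣_.equality (∣Gyx sp)))))
      (trans (F-• C t y) (cong (t * (t * t) *_) (_∣_.equality (∣Fy sp)))) ⟩
    c₀ * (d * + p) + t * (c₁ * d) + t * t * (c₂ * d) + t * (t * t) * (c₃ * d) ≡⟨ alg c₀ c₁ c₂ c₃ d (+ p) t ⟩
    d * poly (c₀ * + p) c₁ c₂ c₃ t ∎
    where
    open ≡-Reasoning
    alg : ∀ a b c e d q t → a * (d * q) + t * (b * d) + t * t * (c * d) + t * (t * t) * (e * d) ≡
      d * (a * q + b * t + c * (t * t) + e * (t * (t * t)))
    alg = solve-∀
  attain : ∀ s j → (∃ λ t → ∃ λ e → poly (c₀ * + p) c₁ c₂ c₃ (+ p * t) ≡ + p * (s + pow p j * e)) →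
    ∃ λ z → ∃ λ e → F C z ≡ pow p (suc k) * (s + pow p j * e)
  attain s j (t , e , eq) = (x ⊕ (+ p * t) • y) , e ,
    trans (F≡poly (+ p * t)) (trans (cong (d *_) eq) (sym (ℤₚ.*-assoc d (+ p) (s + pow p j * e))))

-- `Q` realises multiplication by p^level on the lattice, so C₀ (Q x) = p^(3 level) C x: only κ
-- grows.
AttainsNear-overlattice : ∀ {n p} {C₀ C : Cubic n} → Overlattice p C₀ C → AttainsNear p (F C) → AttainsNear p (F C₀)
AttainsNear-overlattice {p = p} {C₀} {C} M (κ , attain) = (level M ℕ.+ (level M ℕ.+ level M)) ℕ.+ κ , λ s k →
  let x , e , eq = attain s k in fun (Q M) x , e , (begin
    F C₀ (fun (Q M) x)             ≡⟨ sym (F-P M (fun (Q M) x)) ⟩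
    F C (fun (P M) (fun (Q M) x))  ≡⟨ cong (F C) (P∘Q M x) ⟩
    F C (π • x)                    ≡⟨ F-• C π x ⟩
    π * (π * π) * F C x            ≡⟨ cong (π * (π * π) *_) eq ⟩
    π * (π * π) * (pow p κ * (s + pow p k * e)) ≡⟨ sym (ℤₚ.*-assoc (π * (π * π)) (pow p κ) (s + pow p k * e)) ⟩
    π * (π * π) * pow p κ * (s + pow p k * e)   ≡⟨ cong (_* (s + pow p k * e)) (sym pow≡) ⟩
    pow p ((level M ℕ.+ (level M ℕ.+ level M)) ℕ.+ κ) * (s + pow p k * e) ∎)
  where
  open ≡-Reasoning
  π : ℤ
  π = pow p (level M)
  pow≡ : pow p ((level M ℕ.+ (level M ℕ.+ level M)) ℕ.+ κ) ≡ π * (π * π) * pow p κ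
  pow≡ = trans (pow-+ p (level M ℕ.+ (level M ℕ.+ level M)) κ) (cong (_* pow p κ)
    (trans (pow-+ p (level M) (level M ℕ.+ level M)) (cong (π *_) (pow-+ p (level M) (level M)))))

-- 1 + w + ... + w^(j - 1), which for p dividing w is the residue modulo pʲ of 1 / (1 - w) in ℤ_p.
geometric : ℤ → ℕ → ℤ
geometric w zero    = + 0
geometric w (suc j) = + 1 + w * geometric w j

_^ᶻ_ : ℤ → ℕ → ℤ
w ^ᶻ zero  = + 1
w ^ᶻ suc j = w * w ^ᶻ j

geometric-+ : ∀ w i j → geometric w (i ℕ.+ j) - geometric w i ≡ w ^ᶻ i * geometric w j
geometric-+ w zero    j = alg (geometric w j)
  where
  alg : ∀ a → a - + 0 ≡ + 1 * a
  alg = solve-∀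
geometric-+ w (suc i) j = trans (alg₁ w (geometric w (i ℕ.+ j)) (geometric w i))
  (trans (cong (w *_) (geometric-+ w i j)) (sym (ℤₚ.*-assoc w (w ^ᶻ i) (geometric w j))))
  where
  alg₁ : ∀ w a b → (+ 1 + w * a) - (+ 1 + w * b) ≡ w * (a - b)
  alg₁ = solve-∀

geometric-inverse : ∀ w j → + 1 - geometric w j * (+ 1 - w) ≡ w ^ᶻ j
geometric-inverse w zero    = refl
geometric-inverse w (suc j) = trans (alg w (geometric w j)) (cong (w *_) (geometric-inverse w j))
  where
  alg : ∀ w g → + 1 - (+ 1 + w * g) * (+ 1 - w) ≡ w * (+ 1 - g * (+ 1 - w))
  alg = solve-∀

pow∣^ᶻ : ∀ {p w} → + p ∣ w → ∀ j → pow p j ∣ w ^ᶻ j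
pow∣^ᶻ h zero    = ∣-refl
pow∣^ᶻ {p} {w} h (suc j) = ∣-resp-≡ (ℤₚ.*-comm (w ^ᶻ j) w) (∣-*-mono (pow∣^ᶻ h j) h)

module _ (p : ℕ) (pr : Prime p) where
  open Padic p

  private
    toPz : ∀ k {a} → pow p k ∣ a → pz k Unsigned.∣ a
    toPz k h = ∣⇒∣ᵤ (subst (_∣ _) (pow≡+^ p k) h)
    fromPz : ∀ k {a} → pz k Unsigned.∣ a → pow p k ∣ a
    fromPz k {a} h = subst (_∣ a) (sym (pow≡+^ p k)) (∣ᵤ⇒∣ h)

  attainsNear⇒dense : ∀ {r} (a : CubicFormℤ r) → AttainsNear p (λ x → evalℤ a (lookup x)) → DenseRatios a
  attainsNear⇒dense {r} a (κ , attain) α α-valid N =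
    lookup x , lookup y , fy≢0 , γ , γ-valid , (w , w-coherent , γ≈) , ratio
    where
    open ≡-Reasoning
    f : V r → ℤ
    f v = evalℤ a (lookup v)
    c : ℕ → ℤ
    c = num α
    d M : ℕ
    d = den α
    M = N ℕ.+ d
    x y : V r
    e e′ ω u : ℤ
    -- Aiming at p^d with precision d + 1 gives f y = p^(κ + d) u with u ≡ 1 modulo p; the factor
    -- p^d matches the denominator of α.
    y = proj₁ (attain (pow p d) (suc d))
    e = proj₁ (proj₂ (attain (pow p d) (suc d)))
    ω = - (+ p * e)
    u = + 1 - ω
    -- Now f x / f y is close to c_M / p^d. The numerator of α agrees with c_M modulo p^M, and M = N
    -- + d compensates for the denominator.
    x  = proj₁ (attain (c M * u) M)
    e′ = proj₁ (proj₂ (attain (c M * u) M))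
    fy≡ : f y ≡ pow p κ * pow p d * u
    fy≡ = trans (proj₂ (proj₂ (attain (pow p d) (suc d)))) (alg (pow p κ) (pow p d) (+ p) e)
      where
      alg : ∀ k d q e → k * (d + d * q * e) ≡ k * d * (+ 1 - - (q * e))
      alg = solve-∀
    fx≡ : f x ≡ pow p κ * (c M * u + pow p M * e′)
    fx≡ = proj₂ (proj₂ (attain (c M * u) M))
    p∣ω : + p ∣ ω
    p∣ω = ∣m⇒∣-m (∣-self* e)
    fy≢0 : f y ≢ + 0
    fy≢0 h = ℕₚ.<⇒≱ (ℕ.nonTrivial⇒n>1 p {{prime⇒nonTrivial pr}})
      (ℕᵈ.∣⇒≤ (∣⇒∣ᵤ {+ p} {+ 1} (∣-resp-≡ (alg ω) (∣m∣n⇒∣m+n (divides (+ 0) u≡0) p∣ω))))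
      where
      alg : ∀ w → (+ 1 - w) + w ≡ + 1
      alg = solve-∀
      instance
        powκ≢0 : NonZero (pow p κ)
        powκ≢0 = pow-nonZero pr κ
        powd≢0 : NonZero (pow p d)
        powd≢0 = pow-nonZero pr d
        prod≢0 : NonZero (pow p κ * pow p d)
        prod≢0 = ℤₚ.i*j≢0 (pow p κ) (pow p d)
      u≡0 : u ≡ + 0
      u≡0 = ℤₚ.*-cancelˡ-≡ (pow p κ * pow p d) u (+ 0)
        (trans (sym fy≡) (trans h (sym (ℤₚ.*-zeroʳ (pow p κ * pow p d)))))
    inv : ℕ → ℤ
    inv = geometric ω
    inv-coherent : ∀ k j → k ℕ.≤ j → pow p k ∣ inv j - inv k
    inv-coherent k j k≤j = subst (λ i → pow p k ∣ inv i - inv k) (ℕₚ.m+[n∸m]≡n k≤j)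
      (∣-resp-≡ (sym (geometric-+ ω k (j ℕ.∸ k))) (∣m⇒∣m*n (inv (j ℕ.∸ k)) (pow∣^ᶻ p∣ω k)))
    c-coherent : ∀ k j → k ℕ.≤ j → pow p k ∣ c j - c k
    c-coherent k j k≤j = fromPz k (α-valid k j k≤j)
    -- γ = f(x)/f(y) − α, where f(y) = p^(κ+d) u and inv represents 1/u.
    γ : Qp
    γ = (λ j → c M - c j + pow p M * e′ * inv j) /p^ d
    γ-valid : Valid γ
    γ-valid k j k≤j = toPz k (∣-resp-≡ (alg (c M) (c j) (c k) (pow p M * e′) (inv j) (inv k))
      (∣m∣n⇒∣m-n (∣n⇒∣m*n (pow p M * e′) (inv-coherent k j k≤j)) (c-coherent k j k≤j)))
      where
      alg : ∀ m cj ck b ij ik → b * (ij - ik) - (cj - ck) ≡ (m - cj + b * ij) - (m - ck + b * ik)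
      alg = solve-∀
    -- Division by p^M costs M digits, so the quotient modulo pʲ is read off at index j + M.
    q : ℕ → ℤ
    q j = quotient (c-coherent M (j ℕ.+ M) (ℕₚ.m≤n+m M j))
    q≡ : ∀ j → c (j ℕ.+ M) - c M ≡ q j * pow p M
    q≡ j = _∣_.equality (c-coherent M (j ℕ.+ M) (ℕₚ.m≤n+m M j))
    q-coherent : ∀ k j → k ℕ.≤ j → pow p k ∣ q j - q k
    q-coherent k j k≤j = *-cancelʳ-∣ (pow p M) {{pow-nonZero pr M}}
      (subst₂ _∣_ (pow-+ p k M) (trans (alg₁ (c (j ℕ.+ M)) (c (k ℕ.+ M)) (c M))
          (trans (cong₂ _-_ (q≡ j) (q≡ k)) (alg₂ (q j) (q k) (pow p M))))
        (c-coherent (k ℕ.+ M) (j ℕ.+ M) (ℕₚ.+-monoˡ-≤ M k≤j)))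
      where
      alg₁ : ∀ a b m → a - b ≡ (a - m) - (b - m)
      alg₁ = solve-∀
      alg₂ : ∀ a b m → a * m - b * m ≡ (a - b) * m
      alg₂ = solve-∀
    w : ℕ → ℤ
    w j = e′ * inv j - q j
    w-coherent : Coherent w
    w-coherent k j k≤j = toPz k (∣-resp-≡ (alg e′ (inv j) (inv k) (q j) (q k))
      (∣m∣n⇒∣m-n (∣n⇒∣m*n e′ (inv-coherent k j k≤j)) (q-coherent k j k≤j)))
      where
      alg : ∀ e ij ik qj qk → e * (ij - ik) - (qj - qk) ≡ (e * ij - qj) - (e * ik - qk)
      alg = solve-∀
    γ≈ : num γ ≈z (λ k → pz (N ℕ.+ den γ) * w k)
    γ≈ j = toPz j (∣-resp-≡ (begin
      c (j ℕ.+ M) - c j                              ≡⟨ alg₁ (c (j ℕ.+ M)) (c j) (c M) ⟩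
      c M - c j + (c (j ℕ.+ M) - c M)                ≡⟨ cong (λ t → c M - c j + t) (q≡ j) ⟩
      c M - c j + q j * pow p M                      ≡⟨ alg₂ (c M - c j) (q j) (pow p M) e′ (inv j) ⟩
      (c M - c j + pow p M * e′ * inv j) - pow p M * w j ≡⟨ cong (λ t → num γ j - t * w j) (pow≡+^ p M) ⟩
      num γ j - pz M * w j ∎) (c-coherent j (j ℕ.+ M) (ℕₚ.m≤m+n j M)))
      where
      alg₁ : ∀ a b m → a - b ≡ m - b + (a - m)
      alg₁ = solve-∀
      alg₂ : ∀ b q m e i → b + q * m ≡ (b + m * e * i) - m * (e * i - q)
      alg₂ = solve-∀
    ratio : (fromℤ (f x) +q (-q (α *q fromℤ (f y)))) ≈ (γ *q fromℤ (f y))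
    ratio k = toPz k (∣-resp-≡ (sym (begin
      D * (D * f x + + 1 * - (c k * f y)) - D * (num γ k * f y)
        ≡⟨ cong₂ (λ s t → D * (D * s + + 1 * - (c k * t)) - D * (num γ k * t)) fx≡ fy≡′ ⟩
      D * (D * (κ′ * (c M * u + m * e′)) + + 1 * - (c k * (κ′ * D * u))) - D * ((c M - c k + m * e′ * inv k) * (κ′ * D * u))
        ≡⟨ alg D κ′ (c M) (c k) u m e′ (inv k) ⟩
      D * D * κ′ * m * e′ * (+ 1 - inv k * u)
        ≡⟨ cong (D * D * κ′ * m * e′ *_) (geometric-inverse ω k) ⟩
      D * D * κ′ * m * e′ * ω ^ᶻ k ∎)) (∣n⇒∣m*n (D * D * κ′ * m * e′) (pow∣^ᶻ p∣ω k)))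
      where
      D κ′ m : ℤ
      D = pz (d ℕ.+ 0)
      κ′ = pow p κ
      m = pow p M
      fy≡′ : f y ≡ κ′ * D * u
      fy≡′ = trans fy≡ (cong (λ t → κ′ * t * u) (trans (pow≡+^ p d) (cong pz (sym (ℕₚ.+-identityʳ d)))))
      alg : ∀ D k cM ck u m e i →
        D * (D * (k * (cM * u + m * e)) + + 1 * - (ck * (k * D * u))) - D * ((cM - ck + m * e * i) * (k * D * u)) ≡
        D * D * k * m * e * (+ 1 - i * u)
      alg = solve-∀

-- Cubic forms as cubic maps

∑ : ∀ n → (Fin n → ℤ) → ℤ
∑ = sumFin (+ 0) _+_

∑-cong : ∀ n {f g : Fin n → ℤ} → (∀ i → f i ≡ g i) → ∑ n f ≡ ∑ n g
∑-cong zero    e = refl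
∑-cong (suc n) e = cong₂ _+_ (e zero) (∑-cong n (λ i → e (suc i)))

∑-+ : ∀ n (f g : Fin n → ℤ) → ∑ n (λ i → f i + g i) ≡ ∑ n f + ∑ n g
∑-+ zero    f g = refl
∑-+ (suc n) f g = trans (cong (λ s → f zero + g zero + s) (∑-+ n (λ i → f (suc i)) (λ i → g (suc i))))
  (alg (f zero) (g zero) (∑ n (λ i → f (suc i))) (∑ n (λ i → g (suc i))))
  where
  alg : ∀ a b c d → a + b + (c + d) ≡ (a + c) + (b + d)
  alg = solve-∀

∑-* : ∀ n c (f : Fin n → ℤ) → ∑ n (λ i → c * f i) ≡ c * ∑ n f
∑-* zero    c f = sym (ℤₚ.*-zeroʳ c)
∑-* (suc n) c f = trans (cong (λ s → c * f zero + s) (∑-* n c (λ i → f (suc i))))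
  (sym (ℤₚ.*-distribˡ-+ c (f zero) (∑ n (λ i → f (suc i)))))

linear-∑ : ∀ {n} {f : V n → ℤ} → Linear f → ∀ x → f x ≡ ∑ n (λ i → lookup x i * f (𝟙 i))
linear-∑ {f = f} lf []      = trans (Linear.hom lf (+ 0) []) (ℤₚ.*-zeroˡ (f []))
linear-∑ {f = f} lf (a ∷ x) = trans (linear-∷ lf a x) (cong (λ s → a * f (𝟙 zero) + s) (linear-∑ (linear-tail lf) x))

record Trilinear {n} (A : V n → V n → V n → ℤ) : Set where
  field
    lin₁ : ∀ y z → Linear (λ x → A x y z)
    lin₂ : ∀ x z → Linear (λ y → A x y z)
    lin₃ : ∀ x y → Linear (λ z → A x y z)

open Trilinear

-- A is not assumed symmetric, so `G` places y in each of the three slots in turn.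
trilinear⇒cubic : ∀ {n} {A : V n → V n → V n → ℤ} → Trilinear A → Cubic n
trilinear⇒cubic {n} {A} tri = record
  { F    = λ x → A x x x
  ; G    = λ x y → A x x y + A x y x + A y x x
  ; F-⊕  = λ x y → trans (Linear.add (lin₁ tri (x ⊕ y) (x ⊕ y)) x y)
             (trans (cong₂ _+_ (expand x x y) (expand y x y))
               (alg₁ (A x x x) (A x x y) (A x y x) (A x y y) (A y x x) (A y x y) (A y y x) (A y y y)))
  ; F-•  = λ c x → trans (Linear.hom (lin₁ tri (c • x) (c • x)) c x)
             (trans (cong (c *_) (square c x x)) (alg₂ c (A x x x)))
  ; G-⊕ʳ = λ x y z → trans (cong₂ _+_ (cong₂ _+_ (Linear.add (lin₃ tri x x) y z) (Linear.add (lin₂ tri x x) y z))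
             (Linear.add (lin₁ tri x x) y z))
             (alg₃ (A x x y) (A x x z) (A x y x) (A x z x) (A y x x) (A z x x))
  ; G-•ˡ = λ c x y → trans (cong₂ _+_ (cong₂ _+_
             (trans (Linear.hom (lin₁ tri (c • x) y) c x) (cong (c *_) (Linear.hom (lin₂ tri x y) c x)))
             (trans (Linear.hom (lin₁ tri y (c • x)) c x) (cong (c *_) (Linear.hom (lin₃ tri x y) c x))))
             (square c y x))
             (alg₄ c (A x x y) (A x y x) (A y x x))
  ; G-•ʳ = λ c x y → trans (cong₂ _+_ (cong₂ _+_ (Linear.hom (lin₃ tri x x) c y) (Linear.hom (lin₂ tri x x) c y))
             (Linear.hom (lin₁ tri x x) c y))
             (alg₅ c (A x x y) (A x y x) (A y x x))
  }
  where
  expand : ∀ w x y → A w (x ⊕ y) (x ⊕ y) ≡ (A w x x + A w x y) + (A w y x + A w y y)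
  expand w x y = trans (Linear.add (lin₂ tri w (x ⊕ y)) x y)
    (cong₂ _+_ (Linear.add (lin₃ tri w x) x y) (Linear.add (lin₃ tri w y) x y))
  square : ∀ c w x → A w (c • x) (c • x) ≡ c * (c * A w x x)
  square c w x = trans (Linear.hom (lin₂ tri w (c • x)) c x) (cong (c *_) (Linear.hom (lin₃ tri w x) c x))
  alg₁ : ∀ a b c d e f g h →
    ((a + b) + (c + d)) + ((e + f) + (g + h)) ≡ a + (b + c + e) + (g + f + d) + h
  alg₁ = solve-∀
  alg₂ : ∀ c a → c * (c * (c * a)) ≡ c * (c * c) * a
  alg₂ = solve-∀
  alg₃ : ∀ a b c d e f → (a + b) + (c + d) + (e + f) ≡ (a + c + e) + (b + d + f)
  alg₃ = solve-∀
  alg₄ : ∀ c a b d → c * (c * a) + c * (c * b) + c * (c * d) ≡ c * c * (a + b + d)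
  alg₄ = solve-∀
  alg₅ : ∀ c a b d → c * a + c * b + c * d ≡ c * (a + b + d)
  alg₅ = solve-∀

∑³ : ∀ n → (Fin n → Fin n → Fin n → ℤ) → ℤ
∑³ n f = ∑ n λ i → ∑ n λ j → ∑ n λ k → f i j k

∑³-cong : ∀ n {f g : Fin n → Fin n → Fin n → ℤ} → (∀ i j k → f i j k ≡ g i j k) → ∑³ n f ≡ ∑³ n g
∑³-cong n e = ∑-cong n λ i → ∑-cong n λ j → ∑-cong n λ k → e i j k

∑³-+ : ∀ n (f g : Fin n → Fin n → Fin n → ℤ) → ∑³ n (λ i j k → f i j k + g i j k) ≡ ∑³ n f + ∑³ n g
∑³-+ n f g = trans (∑-cong n λ i → trans (∑-cong n λ j → ∑-+ n (f i j) (g i j))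
    (∑-+ n (λ j → ∑ n (f i j)) (λ j → ∑ n (g i j))))
  (∑-+ n (λ i → ∑ n λ j → ∑ n (f i j)) (λ i → ∑ n λ j → ∑ n (g i j)))

∑³-* : ∀ n c (f : Fin n → Fin n → Fin n → ℤ) → ∑³ n (λ i j k → c * f i j k) ≡ c * ∑³ n f
∑³-* n c f = trans (∑-cong n λ i → trans (∑-cong n λ j → ∑-* n c (f i j)) (∑-* n c (λ j → ∑ n (f i j))))
  (∑-* n c (λ i → ∑ n λ j → ∑ n (f i j)))

trilinear : ∀ {r} → CubicFormℤ r → V r → V r → V r → ℤ
trilinear {r} a x y z = ∑³ r λ i j k → a i j k * (lookup x i * (lookup y j * lookup z k))

trilinear-isTrilinear : ∀ {r} (a : CubicFormℤ r) → Trilinear (trilinear a)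
trilinear-isTrilinear {r} a = record
  { lin₁ = λ y z → record
    { add = λ x x′ → trans (∑³-cong r λ i j k → trans (cong (λ t → a i j k * (t * (lookup y j * lookup z k))) (lookup-⊕ x x′ i))
        (add₁ (a i j k) (lookup x i) (lookup x′ i) (lookup y j) (lookup z k))) (∑³-+ r _ _)
    ; hom = λ c x → trans (∑³-cong r λ i j k → trans (cong (λ t → a i j k * (t * (lookup y j * lookup z k))) (lookup-• c x i))
        (hom₁ c (a i j k) (lookup x i) (lookup y j) (lookup z k))) (∑³-* r c _) }
  ; lin₂ = λ x z → record
    { add = λ y y′ → trans (∑³-cong r λ i j k → trans (cong (λ t → a i j k * (lookup x i * (t * lookup z k))) (lookup-⊕ y y′ j))
        (add₂ (a i j k) (lookup x i) (lookup y j) (lookup y′ j) (lookup z k))) (∑³-+ r _ _)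
    ; hom = λ c y → trans (∑³-cong r λ i j k → trans (cong (λ t → a i j k * (lookup x i * (t * lookup z k))) (lookup-• c y j))
        (hom₂ c (a i j k) (lookup x i) (lookup y j) (lookup z k))) (∑³-* r c _) }
  ; lin₃ = λ x y → record
    { add = λ z z′ → trans (∑³-cong r λ i j k → trans (cong (λ t → a i j k * (lookup x i * (lookup y j * t))) (lookup-⊕ z z′ k))
        (add₃ (a i j k) (lookup x i) (lookup y j) (lookup z k) (lookup z′ k))) (∑³-+ r _ _)
    ; hom = λ c z → trans (∑³-cong r λ i j k → trans (cong (λ t → a i j k * (lookup x i * (lookup y j * t))) (lookup-• c z k))
        (hom₃ c (a i j k) (lookup x i) (lookup y j) (lookup z k))) (∑³-* r c _) }
  }
  where
  add₁ : ∀ a x x′ y z → a * ((x + x′) * (y * z)) ≡ a * (x * (y * z)) + a * (x′ * (y * z))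
  add₁ = solve-∀
  add₂ : ∀ a x y y′ z → a * (x * ((y + y′) * z)) ≡ a * (x * (y * z)) + a * (x * (y′ * z))
  add₂ = solve-∀
  add₃ : ∀ a x y z z′ → a * (x * (y * (z + z′))) ≡ a * (x * (y * z)) + a * (x * (y * z′))
  add₃ = solve-∀
  hom₁ : ∀ c a x y z → a * (c * x * (y * z)) ≡ c * (a * (x * (y * z)))
  hom₁ = solve-∀
  hom₂ : ∀ c a x y z → a * (x * (c * y * z)) ≡ c * (a * (x * (y * z)))
  hom₂ = solve-∀
  hom₃ : ∀ c a x y z → a * (x * (y * (c * z))) ≡ c * (a * (x * (y * z)))
  hom₃ = solve-∀

substitute : ∀ {r s} → CubicFormℤ s → LinearMap r s → CubicFormℤ r
substitute a f i j k = trilinear a (fun f (𝟙 i)) (fun f (𝟙 j)) (fun f (𝟙 k))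

linear-∘ : ∀ {n m} {f : V m → ℤ} → Linear f → (g : LinearMap n m) → Linear (λ x → f (fun g x))
linear-∘ {f = f} lf g = record
  { add = λ x y → trans (cong f (LinearMap.add g x y)) (Linear.add lf (fun g x) (fun g y))
  ; hom = λ c x → trans (cong f (LinearMap.hom g c x)) (Linear.hom lf c (fun g x))
  }

evalℤ-substitute : ∀ {r s} (a : CubicFormℤ s) (f : LinearMap r s) x →
  evalℤ (substitute a f) (lookup x) ≡ evalℤ a (lookup (fun f x))
evalℤ-substitute {r} a f x = sym (begin
  A y y y
    ≡⟨ linear-∑ (linear-∘ (lin₁ tri y y) f) x ⟩
  (∑ r λ i → lookup x i * A (e i) y y)
    ≡⟨ (∑-cong r λ i → trans (cong (lookup x i *_) (linear-∑ (linear-∘ (lin₂ tri (e i) y) f) x))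
         (sym (∑-* r (lookup x i) (λ j → lookup x j * A (e i) (e j) y)))) ⟩
  (∑ r λ i → ∑ r λ j → lookup x i * (lookup x j * A (e i) (e j) y))
    ≡⟨ (∑-cong r λ i → ∑-cong r λ j → trans
         (cong (λ t → lookup x i * (lookup x j * t)) (linear-∑ (linear-∘ (lin₃ tri (e i) (e j)) f) x))
         (trans (sym (ℤₚ.*-assoc (lookup x i) (lookup x j) _))
           (sym (∑-* r (lookup x i * lookup x j) (λ k → lookup x k * A (e i) (e j) (e k)))))) ⟩
  ∑³ r (λ i j k → lookup x i * lookup x j * (lookup x k * A (e i) (e j) (e k)))
    ≡⟨ ∑³-cong r (λ i j k → alg (lookup x i) (lookup x j) (lookup x k) (A (e i) (e j) (e k))) ⟩
  ∑³ r (λ i j k → A (e i) (e j) (e k) * (lookup x i * (lookup x j * lookup x k))) ∎)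
  where
  open ≡-Reasoning
  A = trilinear a
  tri = trilinear-isTrilinear a
  y = fun f x
  e : Fin r → V _
  e i = fun f (𝟙 i)
  alg : ∀ x y z b → x * y * (z * b) ≡ b * (x * (y * z))
  alg = solve-∀

toCubic : ∀ {r} → CubicFormℤ r → Cubic r
toCubic a = trilinear⇒cubic (trilinear-isTrilinear a)

-- Cyclicity and linearity make every `Φ` with v among its arguments vanish. Then 2 G x v = Φ x x v,
-- 2 G v x = Φ v v x and 3 F v = G v v; over ℤ the factors 2 and 3 cancel.
F-kernel : ∀ {n} (C : Cubic n) v → (∀ i j → Φ C (𝟙 i) (𝟙 j) v ≡ + 0) → ∀ c x → F C (x ⊕ c • v) ≡ F C x
F-kernel C v ker c x = begin
  F C (x ⊕ c • v)                                      ≡⟨ F-⊕ C x (c • v) ⟩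
  F C x + G C x (c • v) + G C (c • v) x + F C (c • v)  ≡⟨ cong₂ _+_ (cong₂ (λ s t → F C x + s + t)
    (trans (G-•ʳ C c x v) (cong (c *_) Gxv≡0)) (trans (G-•ˡ C c v x) (cong (c * c *_) Gvx≡0)))
    (trans (F-• C c v) (cong (c * (c * c) *_) Fv≡0)) ⟩
  F C x + c * + 0 + c * c * + 0 + c * (c * c) * + 0    ≡⟨ alg c (F C x) ⟩
  F C x                                                ∎
  where
  open ≡-Reasoning
  alg : ∀ c f → f + c * + 0 + c * c * + 0 + c * (c * c) * + 0 ≡ f
  alg = solve-∀
  Φv𝟙 : ∀ i y → Φ C v (𝟙 i) y ≡ + 0
  Φv𝟙 i = linear-ext (Φ-linear C v (𝟙 i)) (λ j → trans (Φ-cyclic C v (𝟙 i) (𝟙 j)) (ker i j))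
  Φxv : ∀ x y → Φ C x v y ≡ + 0
  Φxv x = linear-ext (Φ-linear C x v) (λ i → trans (Φ-cyclic C x v (𝟙 i)) (Φv𝟙 i x))
  halve : ∀ {a} → + 2 * + 1 * a ≡ + 0 → a ≡ + 0
  halve {a} h = ℤₚ.*-cancelˡ-≡ (+ 2) a (+ 0) h
  diagonal : ∀ x z → Φ C x x z ≡ + 0 → G C x z ≡ + 0
  diagonal x z h = halve (trans (sym (Φ-diagonal C (+ 1) x z)) (trans (cong (λ w → Φ C w x z) (1-• x)) h))
  Gxv≡0 : G C x v ≡ + 0
  Gxv≡0 = diagonal x v (trans (sym (Φ-cyclic C v x x)) (trans (Φ-swap C v x x) (Φxv x x)))
  Gvx≡0 : G C v x ≡ + 0
  Gvx≡0 = diagonal v x (Φxv v x)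
  Fv≡0 : F C v ≡ + 0
  Fv≡0 = ℤₚ.*-cancelˡ-≡ (+ 3) (F C v) (+ 0)
    (trans (sym (G-diagonal C v)) (diagonal v v (Φxv v v)))

-- Degenerate forms

block : ∀ {n} → (α β γ δ : ℤ) → LinearMap (2 ℕ.+ n) (2 ℕ.+ n)
block {n} α β γ δ = record { fun = f ; add = f-add ; hom = f-hom }
  where
  f : V (2 ℕ.+ n) → V (2 ℕ.+ n)
  f (s ∷ t ∷ x) = α * s + β * t ∷ γ * s + δ * t ∷ x
  add-alg : ∀ a b s t s′ t′ → a * (s + s′) + b * (t + t′) ≡ (a * s + b * t) + (a * s′ + b * t′)
  add-alg = solve-∀
  hom-alg : ∀ a b c s t → a * (c * s) + b * (c * t) ≡ c * (a * s + b * t)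
  hom-alg = solve-∀
  f-add : ∀ x y → f (x ⊕ y) ≡ f x ⊕ f y
  f-add (s ∷ t ∷ x) (s′ ∷ t′ ∷ y) = cong₂ _∷_ (add-alg α β s t s′ t′) (cong (_∷ x ⊕ y) (add-alg γ δ s t s′ t′))
  f-hom : ∀ c x → f (c • x) ≡ c • f x
  f-hom c (s ∷ t ∷ x) = cong₂ _∷_ (hom-alg α β c s t) (cong (_∷ c • x) (hom-alg γ δ c s t))

consₗ : ∀ {n m} → LinearMap n m → LinearMap (suc n) (suc m)
consₗ {n} {m} f = record { fun = g ; add = g-add ; hom = g-hom }
  where
  g : V (suc n) → V (suc m)
  g (a ∷ x) = a ∷ fun f x
  g-add : ∀ x y → g (x ⊕ y) ≡ g x ⊕ g y
  g-add (a ∷ x) (b ∷ y) = cong (a + b ∷_) (LinearMap.add f x y)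
  g-hom : ∀ c x → g (c • x) ≡ c • g x
  g-hom c (a ∷ x) = cong (c * a ∷_) (LinearMap.hom f c x)

record Unimodular (n : ℕ) : Set where
  field
    to from : LinearMap n n
    from∘to : ∀ x → fun from (fun to x) ≡ x
    to∘from : ∀ x → fun to (fun from x) ≡ x

open Unimodular

-- For (a , b) = (α g , β g), the block with rows (β , -α) and (s , t) has determinant 1 and gives
-- (0 , g). Repeating this moves the gcd of the coordinates to the last place.
rotate : ∀ {n} (v : V (suc n)) → ∃ λ (U : Unimodular (suc n)) → ∃ λ g → fun (to U) v ≡ g • 𝟙 (Fin.fromℕ n)
rotate {zero} (a ∷ []) =
  record { to = idₗ ; from = idₗ ; from∘to = λ _ → refl ; to∘from = λ _ → refl } , a , cong (_∷ []) (sym (ℤₚ.*-identityʳ a))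
rotate {suc n} (a ∷ b ∷ x) =
  let g , α , β , s , t , a≡ , b≡ , sα+tβ≡1 = bezout a b
      U , h , Uv≡ = rotate (s * a + t * b ∷ x)
      one : ∀ c {u} → u ≡ s * α + t * β → u * c ≡ c
      one c {u} e = trans (cong (_* c) (trans e sα+tβ≡1)) (ℤₚ.*-identityˡ c)
      B  = block β (- α) s t
      B⁻ = block t α (- s) β
  in record
    { to = consₗ (to U) ∘ₗ B
    ; from = B⁻ ∘ₗ consₗ (from U)
    ; from∘to = λ { (y ∷ z ∷ w) → trans
        (cong (λ v → fun B⁻ (β * y + - α * z ∷ v)) (from∘to U (s * y + t * z ∷ w)))
        (cong₂ _∷_ (trans (alg₁ α β s t y z) (one y refl)) (cong (_∷ w) (trans (alg₂ α β s t y z) (one z refl)))) }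
    ; to∘from = λ { (y ∷ z) → to∘from-alg α β s t sα+tβ≡1 (to U) (fun (from U) z) y z (to∘from U z) }
    } , h , cong₂ _∷_ (trans (cong₂ (λ c d → β * c + - α * d) a≡ b≡) (trans (alg₃ α β g) (sym (ℤₚ.*-zeroʳ h)))) Uv≡
  where
  alg₁ : ∀ α β s t y z → t * (β * y + - α * z) + α * (s * y + t * z) ≡ (s * α + t * β) * y
  alg₁ = solve-∀
  alg₂ : ∀ α β s t y z → - s * (β * y + - α * z) + β * (s * y + t * z) ≡ (s * α + t * β) * z
  alg₂ = solve-∀
  alg₃ : ∀ α β g → β * (α * g) + - α * (β * g) ≡ + 0
  alg₃ = solve-∀
  alg₄ : ∀ α β s t y z → β * (t * y + α * z) + - α * (- s * y + β * z) ≡ (s * α + t * β) * y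
  alg₄ = solve-∀
  alg₅ : ∀ α β s t y z → s * (t * y + α * z) + t * (- s * y + β * z) ≡ (s * α + t * β) * z
  alg₅ = solve-∀
  to∘from-alg : ∀ α β s t → s * α + t * β ≡ + 1 → (f : LinearMap (suc n) (suc n)) (u : V (suc n)) (y : ℤ) (z : V (suc n)) →
    fun f u ≡ z → fun (consₗ f ∘ₗ block β (- α) s t ∘ₗ block t α (- s) β) (y ∷ u) ≡ y ∷ z
  to∘from-alg α β s t e f (u ∷ w) y z fu≡z = cong₂ _∷_
    (trans (alg₄ α β s t y u) (trans (cong (_* y) e) (ℤₚ.*-identityˡ y)))
    (trans (cong (λ c → fun f (c ∷ w)) (trans (alg₅ α β s t y u) (trans (cong (_* u) e) (ℤₚ.*-identityˡ u)))) fu≡z)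

lookup-𝟘 : ∀ {n} (i : Fin n) → lookup 𝟘 i ≡ + 0
lookup-𝟘 i = Vecₚ.lookup-replicate i (+ 0)

lookup-𝟙-≢ : ∀ {n} (i j : Fin n) → i ≢ j → lookup (𝟙 j) i ≡ + 0
lookup-𝟙-≢ zero    zero    h = ⊥-elim (h refl)
lookup-𝟙-≢ zero    (suc j) h = refl
lookup-𝟙-≢ (suc i) zero    h = lookup-𝟘 i
lookup-𝟙-≢ (suc i) (suc j) h = lookup-𝟙-≢ i j (λ e → h (cong suc e))

-- If U takes v to a multiple of the last basis vector e, then U⁻¹ e lies in the kernel with v, and
-- C ∘ U⁻¹ does not involve the last variable; W is U⁻¹ after dropping that variable.
kernel⇒substitution : ∀ {n} (a : CubicFormℤ (suc n)) v → v ≢ 𝟘 → (∀ i j → Φ (toCubic a) (𝟙 i) (𝟙 j) v ≡ + 0) →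
  ∃ λ (U : Unimodular (suc n)) → ∃ λ (W : LinearMap (suc n) (suc n)) →
  fun W (𝟙 (Fin.fromℕ n)) ≡ 𝟘 × (∀ x → evalℤ a (lookup (fun W (fun (to U) x))) ≡ evalℤ a (lookup x))
kernel⇒substitution {n} a v v≢0 ker = finish (rotate v)
  where
  C : Cubic (suc n)
  C = toCubic a
  ℓ : Fin (suc n)
  ℓ = Fin.fromℕ n
  finish : (∃ λ (U : Unimodular (suc n)) → ∃ λ g → fun (to U) v ≡ g • 𝟙 ℓ) → _
  finish (U , g , Tv≡) = U , W , W-last , λ x → trans (sym (F-kernel C w ker-w (lookup (fun (to U) x) ℓ) (fun W (fun (to U) x))))
      (cong (F C) (trans (S-decompose (fun (to U) x)) (from∘to U x)))
    where
    w : V (suc n)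
    w = fun (from U) (𝟙 ℓ)
    v≡ : v ≡ g • w
    v≡ = trans (sym (from∘to U v)) (trans (cong (fun (from U)) Tv≡) (LinearMap.hom (from U) g (𝟙 ℓ)))
    g≢0 : g ≢ + 0
    g≢0 e = v≢0 (trans v≡ (trans (cong (_• w) e) (0-• w)))
    ker-w : ∀ i j → Φ C (𝟙 i) (𝟙 j) w ≡ + 0
    ker-w i j = ℤₚ.*-cancelˡ-≡ g _ (+ 0) {{ℤ.≢-nonZero g≢0}}
      (trans (sym (Linear.hom (Φ-linear C (𝟙 i) (𝟙 j)) g w))
        (trans (cong (Φ C (𝟙 i) (𝟙 j)) (sym v≡)) (trans (ker i j) (sym (ℤₚ.*-zeroʳ g)))))
    dropLast W : LinearMap (suc n) (suc n)
    dropLast = idₗ +ₗ rankOne ℓ (- + 1 • 𝟙 ℓ)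
    W = from U ∘ₗ dropLast
    cancel₁ : ∀ {n} (e : V n) → e ⊕ + 1 • - + 1 • e ≡ 𝟘
    cancel₁ []      = refl
    cancel₁ (b ∷ e) = cong₂ _∷_ (alg b) (cancel₁ e)
      where
      alg : ∀ b → b + + 1 * (- + 1 * b) ≡ + 0
      alg = solve-∀
    cancel₂ : ∀ {n} c (x e : V n) → (x ⊕ c • - + 1 • e) ⊕ c • e ≡ x
    cancel₂ c []      []      = refl
    cancel₂ c (b ∷ x) (d ∷ e) = cong₂ _∷_ (alg c b d) (cancel₂ c x e)
      where
      alg : ∀ c b d → (b + c * (- + 1 * d)) + c * d ≡ b
      alg = solve-∀
    W-last : fun W (𝟙 ℓ) ≡ 𝟘
    W-last = trans (cong (fun (from U)) (trans (cong (λ t → 𝟙 ℓ ⊕ t • - + 1 • 𝟙 ℓ) (lookup-𝟙 ℓ)) (cancel₁ (𝟙 ℓ))))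
      (trans (cong (fun (from U)) (sym (0-• 𝟘))) (trans (LinearMap.hom (from U) (+ 0) 𝟘) (0-• (fun (from U) 𝟘))))
    S-decompose : ∀ y → fun W y ⊕ lookup y ℓ • w ≡ fun (from U) y
    S-decompose y = trans (cong (fun W y ⊕_) (sym (LinearMap.hom (from U) (lookup y ℓ) (𝟙 ℓ))))
      (trans (sym (LinearMap.add (from U) (fun dropLast y) (lookup y ℓ • 𝟙 ℓ)))
        (cong (fun (from U)) (cancel₂ (lookup y ℓ) y (𝟙 ℓ))))

-- Transfer of integral substitutions to ℚ_p

module _ (p : ℕ) (pr : Prime p) where
  open Padic p

  private
    pz-nonZero : ∀ e → NonZero (pz e)
    pz-nonZero e = subst NonZero (pow≡+^ p e) (pow-nonZero pr e)

    pz-+ : ∀ a b → pz (a ℕ.+ b) ≡ pz a * pz b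
    pz-+ a b = trans (cong +_ (ℕₚ.^-distribˡ-+-* p a b)) (ℤₚ.pos-* (p ^ a) (p ^ b))

    ∣0 : ∀ d {a} → a ≡ + 0 → d Unsigned.∣ a
    ∣0 d e = ∣⇒∣ᵤ {d} (divides (+ 0) e)

  -- At index k, the number q is the fraction n / p ^ e.
  record Represents (k e : ℕ) (q : Qp) (n : ℤ) : Set where
    constructor represents
    field cross-multiplied : pz e * num q k ≡ pz (den q) * n

  represents-+ : ∀ {k e q s n m} → Represents k e q n → Represents k e s m → Represents k e (q +q s) (n + m)
  represents-+ {k} {e} {q} {s} {n} {m} (represents hq) (represents hs) = represents (begin
    pz e * (pz (den s) * num q k + pz (den q) * num s k)
      ≡⟨ alg₁ (pz e) (pz (den s)) (num q k) (pz (den q)) (num s k) ⟩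
    pz (den s) * (pz e * num q k) + pz (den q) * (pz e * num s k)
      ≡⟨ cong₂ (λ u v → pz (den s) * u + pz (den q) * v) hq hs ⟩
    pz (den s) * (pz (den q) * n) + pz (den q) * (pz (den s) * m)
      ≡⟨ alg₂ (pz (den s)) (pz (den q)) n m ⟩
    pz (den q) * pz (den s) * (n + m)
      ≡⟨ cong (_* (n + m)) (sym (pz-+ (den q) (den s))) ⟩
    pz (den q ℕ.+ den s) * (n + m) ∎)
    where
    open ≡-Reasoning
    alg₁ : ∀ e b x a y → e * (b * x + a * y) ≡ b * (e * x) + a * (e * y)
    alg₁ = solve-∀
    alg₂ : ∀ b a n m → b * (a * n) + a * (b * m) ≡ a * b * (n + m)
    alg₂ = solve-∀

  represents-* : ∀ {k e e′ q s n m} → Represents k e q n → Represents k e′ s m → Represents k (e ℕ.+ e′) (q *q s) (n * m)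
  represents-* {k} {e} {e′} {q} {s} {n} {m} (represents hq) (represents hs) = represents (begin
    pz (e ℕ.+ e′) * (num q k * num s k)       ≡⟨ cong (_* (num q k * num s k)) (pz-+ e e′) ⟩
    pz e * pz e′ * (num q k * num s k)        ≡⟨ alg (pz e) (pz e′) (num q k) (num s k) ⟩
    (pz e * num q k) * (pz e′ * num s k)      ≡⟨ cong₂ _*_ hq hs ⟩
    (pz (den q) * n) * (pz (den s) * m)       ≡⟨ alg (pz (den q)) n (pz (den s)) m ⟩
    pz (den q) * pz (den s) * (n * m)         ≡⟨ cong (_* (n * m)) (sym (pz-+ (den q) (den s))) ⟩
    pz (den q ℕ.+ den s) * (n * m)            ∎)
    where
    open ≡-Reasoning
    alg : ∀ a b c d → a * b * (c * d) ≡ (a * c) * (b * d)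
    alg = solve-∀

  represents-∑ : ∀ {k e} n {f : Fin n → Qp} {g : Fin n → ℤ} → (∀ i → Represents k e (f i) (g i)) →
    Represents k e (sumFin 0q _+q_ n f) (∑ n g)
  represents-∑ {e = e} zero h = represents (ℤₚ.*-zeroʳ (pz e))
  represents-∑ {k} {e} (suc n) {f} {g} h =
    represents-+ (h zero) (represents-∑ n (λ i → h (suc i)))

  represents-fromℤ : ∀ {k} c → Represents k 0 (fromℤ c) c
  represents-fromℤ c = represents refl

  represents-eval : ∀ {k e r} (a : CubicFormℤ r) {x : VecQ r} {X : Fin r → ℤ} → (∀ i → Represents k e (x i) (X i)) →
    Represents k (e ℕ.+ (e ℕ.+ e)) (evalQ (liftForm a) x) (evalℤ a X)
  represents-eval {k} {e} {r} a {x} {X} h =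
    represents-∑ r λ i → represents-∑ r λ j → represents-∑ r λ l →
      represents-* (represents-fromℤ (a i j l))
        (represents-* (h i) (represents-* (h j) (h l)))

  -- At each index both sides are the same rational number, so the congruence behind ≈ holds as an
  -- equality of integers.
  represents⇒≈ : ∀ {q s} → (∀ k → ∃ λ e → ∃ λ n → Represents k e q n × Represents k e s n) → q ≈ s
  represents⇒≈ {q} {s} h k = let e , n , represents hq , represents hs = h k in
    ∣0 (pz k) (trans (cong (_- pz (den q) * num s k)
      (ℤₚ.*-cancelˡ-≡ (pz e) _ _ {{pz-nonZero e}} (begin
        pz e * (pz (den s) * num q k)   ≡⟨ alg (pz e) (pz (den s)) (num q k) ⟩
        pz (den s) * (pz e * num q k)   ≡⟨ cong (pz (den s) *_) hq ⟩
        pz (den s) * (pz (den q) * n)   ≡⟨ alg (pz (den s)) (pz (den q)) n ⟩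
        pz (den q) * (pz (den s) * n)   ≡⟨ cong (pz (den q) *_) (sym hs) ⟩
        pz (den q) * (pz e * num s k)   ≡⟨ alg (pz (den q)) (pz e) (num s k) ⟩
        pz e * (pz (den q) * num s k)   ∎)))
      (ℤₚ.+-inverseʳ (pz (den q) * num s k)))
    where
    open ≡-Reasoning
    alg : ∀ a b c → a * (b * c) ≡ b * (a * c)
    alg = solve-∀

  commonDenominator : ∀ {r} (x : VecQ r) → ∃ λ e → ∀ i → den (x i) ℕ.≤ e
  commonDenominator {zero}  x = 0 , λ ()
  commonDenominator {suc r} x = let e , h = commonDenominator (λ i → x (suc i)) in
    den (x zero) ℕ.+ e , λ { zero → ℕₚ.m≤m+n (den (x zero)) e ; (suc i) → ℕₚ.≤-trans (h i) (ℕₚ.m≤n+m e (den (x zero))) }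

  represents-common : ∀ {k e q} → den q ℕ.≤ e → Represents k e q (pz (e ℕ.∸ den q) * num q k)
  represents-common {k} {e} {q} h = represents (trans (cong (_* num q k)
    (trans (cong pz (sym (ℕₚ.m+[n∸m]≡n h))) (pz-+ (den q) (e ℕ.∸ den q))))
    (ℤₚ.*-assoc (pz (den q)) (pz (e ℕ.∸ den q)) (num q k)))

  matrix : ∀ {r} → LinearMap r r → MatQ r
  matrix f i j = fromℤ (lookup (fun f (𝟙 j)) i)

  fromℤ-valid : ∀ c → Valid (fromℤ c)
  fromℤ-valid c k j _ = ∣0 (pz k) (ℤₚ.+-inverseʳ c)

  lookup-linear : ∀ {n m} (f : LinearMap n m) i → Linear (λ x → lookup (fun f x) i)
  lookup-linear f i = record
    { add = λ x y → trans (cong (λ v → lookup v i) (LinearMap.add f x y)) (lookup-⊕ (fun f x) (fun f y) i)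
    ; hom = λ c x → trans (cong (λ v → lookup v i) (LinearMap.hom f c x)) (lookup-• c (fun f x) i)
    }

  represents-matrix : ∀ {k e r} (f : LinearMap r r) {y : VecQ r} (Y : V r) → (∀ j → Represents k e (y j) (lookup Y j)) →
    ∀ i → Represents k e ((matrix f · y) i) (lookup (fun f Y) i)
  represents-matrix {k} {e} {r} f {y} Y h i = subst (Represents k e ((matrix f · y) i))
    (trans (∑-cong r (λ j → ℤₚ.*-comm (lookup (fun f (𝟙 j)) i) (lookup Y j))) (sym (linear-∑ (lookup-linear f i) Y)))
    (represents-∑ r λ j → represents-* (represents-fromℤ (lookup (fun f (𝟙 j)) i)) (h j))

  represents-idMat : ∀ {k r} (i j : Fin r) → Represents k 0 (idMat i j) (lookup (𝟙 j) i)
  represents-idMat i j with toℕ i ℕ.≟ toℕ j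
  ... | yes e = represents (cong (+ 1 *_) (sym (trans (cong (λ t → lookup (𝟙 j) t) (Finₚ.toℕ-injective e)) (lookup-𝟙 j))))
  ... | no ¬e = represents (cong (+ 1 *_) (sym (lookup-𝟙-≢ i j (λ e → ¬e (cong toℕ e)))))

  matrix-inverse : ∀ {r} (f g : LinearMap r r) → (∀ x → fun f (fun g x) ≡ x) → (matrix f ⊗ matrix g) ≈M idMat
  matrix-inverse f g inverse i j = represents⇒≈ {(matrix f ⊗ matrix g) i j} {idMat i j} λ k →
    0 , lookup (𝟙 j) i ,
    subst (λ v → Represents k 0 ((matrix f ⊗ matrix g) i j) (lookup v i)) (inverse (𝟙 j))
      (represents-matrix f {λ l → matrix g l j} (fun g (𝟙 j)) (λ l → represents-fromℤ (lookup (fun g (𝟙 j)) l)) i) ,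
    represents-idMat i j

  -- The form is C ∘ W in the variables `to U` x: W kills the last basis vector, and W ∘ `to U`
  -- moves a vector only by multiples of a kernel vector. As both maps are integral, the identity
  -- over ℤ transfers after denominators are cleared at each index.
  kernel⇒degenerate : ∀ {n} (a : CubicFormℤ (suc n)) v → v ≢ 𝟘 → (∀ i j → Φ (toCubic a) (𝟙 i) (𝟙 j) v ≡ + 0) →
    EquivToFormIn a n
  kernel⇒degenerate {n} a v v≢0 ker = build (kernel⇒substitution a v v≢0 ker)
    where
    build : (∃ λ (U : Unimodular (suc n)) → ∃ λ (W : LinearMap (suc n) (suc n)) →
      fun W (𝟙 (Fin.fromℕ n)) ≡ 𝟘 × (∀ x → evalℤ a (lookup (fun W (fun (to U) x))) ≡ evalℤ a (lookup x))) →
      EquivToFormIn a n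
    build (U , W , W-last , W∘T) =
      liftForm D , matrix (to U) ,
      (λ i j k → fromℤ-valid (D i j k)) , (λ i j → fromℤ-valid (lookup (fun (to U) (𝟙 j)) i)) ,
      (matrix (from U) , (λ i j → fromℤ-valid (lookup (fun (from U) (𝟙 j)) i)) ,
        matrix-inverse (from U) (to U) (from∘to U) , matrix-inverse (to U) (from U) (to∘from U)) ,
      involves , equivalent
      where
      D : CubicFormℤ (suc n)
      D = substitute a W
      W≡𝟘 : ∀ i → ¬ toℕ i < n → fun W (𝟙 i) ≡ 𝟘
      W≡𝟘 i i≮n = trans (cong (λ l → fun W (𝟙 l)) (Finₚ.toℕ-injective (trans
        (ℕₚ.≤-antisym (ℕₚ.≤-pred (Finₚ.toℕ<n i)) (ℕₚ.≮⇒≥ i≮n)) (sym (Finₚ.toℕ-fromℕ n))))) W-last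
      at𝟘 : ∀ {f : V (suc n) → ℤ} {x} → Linear f → x ≡ 𝟘 → f x ≡ + 0
      at𝟘 {f} lf e = trans (cong f (trans e (sym (0-• 𝟘)))) (trans (Linear.hom lf (+ 0) 𝟘) (ℤₚ.*-zeroˡ (f 𝟘)))
      tri : Trilinear (trilinear a)
      tri = trilinear-isTrilinear a
      involves : InvolvesOnly n (liftForm D)
      involves i j k h l = ∣0 (pz l) (trans (cong (λ t → + 1 * t - + 1 * + 0) D≡0) refl)
        where
        D≡0 : D i j k ≡ + 0
        D≡0 with toℕ i ℕ.<? n | toℕ j ℕ.<? n | toℕ k ℕ.<? n
        ... | no i≮n | _ | _ = at𝟘 (Trilinear.lin₁ tri (fun W (𝟙 j)) (fun W (𝟙 k))) (W≡𝟘 i i≮n)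
        ... | _ | no j≮n | _ = at𝟘 (Trilinear.lin₂ tri (fun W (𝟙 i)) (fun W (𝟙 k))) (W≡𝟘 j j≮n)
        ... | _ | _ | no k≮n = at𝟘 (Trilinear.lin₃ tri (fun W (𝟙 i)) (fun W (𝟙 j))) (W≡𝟘 k k≮n)
        ... | yes i<n | yes j<n | yes k<n = ⊥-elim (h (i<n , j<n , k<n))
      equivalent : (x : VecQ (suc n)) → ValidVec x → evalQ (liftForm a) x ≈ evalQ (liftForm D) (matrix (to U) · x)
      equivalent x _ = represents⇒≈ {evalQ (liftForm a) x} {evalQ (liftForm D) (matrix (to U) · x)} λ k →
        let e , den≤e = commonDenominator x
            numerator : Fin (suc n) → ℤ
            numerator i = pz (e ℕ.∸ den (x i)) * num (x i) k
            X = tabulate numerator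
            hx : ∀ i → Represents k e (x i) (lookup X i)
            hx i = subst (Represents k e (x i)) (sym (Vecₚ.lookup∘tabulate numerator i)) (represents-common {k} {e} {x i} (den≤e i))
        in e ℕ.+ (e ℕ.+ e) , evalℤ a (lookup X) ,
           represents-eval a {x} {lookup X} hx ,
           subst (Represents k (e ℕ.+ (e ℕ.+ e)) (evalQ (liftForm D) (matrix (to U) · x)))
             (trans (evalℤ-substitute a W (fun (to U) X)) (W∘T X))
             (represents-eval D {matrix (to U) · x} {lookup (fun (to U) X)} (represents-matrix (to U) {x} X hx))

nonzero? : ∀ n (f : Fin n × Fin n → ℤ) → (∃ λ i → f i ≢ + 0) ⊎ (∀ i → f i ≡ + 0)
nonzero? n f with Finₚ.any? (λ i → Finₚ.any? (λ j → ¬? (f (i , j) ℤₚ.≟ + 0)))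
... | yes (i , j , h) = inj₁ ((i , j) , h)
... | no h = inj₂ (λ { (i , j) → decidable-stable (f (i , j) ℤₚ.≟ + 0) (λ h′ → h (i , j , h′)) })

theorem1p4 : (p : ℕ) → Prime p → (r : ℕ) → 9 < r → (a : CubicFormℤ r) →
    Primitive a → Padic.NonDegenerate p a → Padic.DenseRatios p a
-- The functionals are the second derivatives of C along pairs of basis vectors. A common kernel
-- vector would make C equivalent to a form in r - 1 variables.
theorem1p4 p pr r@(suc n) 9<r a _ nondegenerate = [ degenerate , dense ]′
  (kernel-or-bound (nonzero? r) r (λ (i , j) → Φ C (𝟙 i) (𝟙 j)) (λ (i , j) → Φ-linear C (𝟙 i) (𝟙 j)))
  where
  C : Cubic r
  C = toCubic a
  degenerate : (∃ λ v → v ≢ 𝟘 × (∀ ((i , j) : Fin r × Fin r) → Φ C (𝟙 i) (𝟙 j) v ≡ + 0)) → Padic.DenseRatios p a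
  degenerate (v , v≢0 , ker) =
    ⊥-elim (nondegenerate n ℕₚ.≤-refl (kernel⇒degenerate p pr a v v≢0 (λ i j → ker (i , j))))
  dense : (∃ λ Δ → Δ ≢ + 0 × (∀ d x → (∀ ((i , j) : Fin r × Fin r) → d ∣ Φ C (𝟙 i) (𝟙 j) x) →
    ∀ l → d ∣ Δ * lookup x l)) → Padic.DenseRatios p a
  dense (Δ , Δ≢0 , bound) = attainsNear⇒dense p pr a
    (Descent.result pr 9<r C Δ Δ≢0 (λ d x h → bound d x (λ (i , j) → h i j)) (AttainsNear p (F C))
      (λ D M k x y s → AttainsNear-overlattice M (smooth⇒AttainsNear {k = k} pr D s)))
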